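{- For any (fixed) odd integer $d>2$, the random graph $G_{n,d}$ is not a.a.s. $(d-1)/2$-resilient with respect to Hamiltonicity; that is, the probability that $G_{n,d}$ is $(d-1)/2$-resilient with respect to Hamiltonicity does not tend to $1$ as $n\to\infty$.
   Context: All graphs are simple and undirected. For $n,d\in\mathbb{N}$ with $d<n$ and $nd$ even, $G_{n,d}$ denotes a graph chosen uniformly at random from the set of all $d$-regular graphs on vertex set $[n]=\{1,\dots,n\}$; using this notation implicitly assumes $nd$ even (so limits are over $n$ with $nd$ even). An event holds a.a.s. if its probability tends to $1$ as $n\to\infty$. For $H\subseteq G$ (a spanning subgraph), $G\setminus H$ is the graph on $V(G)$ with edge set $E(G)\setminus E(H)$, and $\Delta(H)$ is the maximum degree of $H$. The local resilience of a graph $G$ with respect to a property $\mathcal{P}$ is the maximum number $r\in\mathbb{N}$ such that, for all $H\subseteq G$ with $\Delta(H)<r$, the graph $G\setminus H$ satisfies $\mathcal{P}$. $G$ is $r$-resilient with respect to $\mathcal{P}$ if the local resilience of $G$ is greater than $r$; that is, $G\setminus H$ satisfies $\mathcal{P}$ for every $H\subseteq G$ with $\Delta(H)\leq r$. Hamiltonicity is the property of containing a cycle that covers all vertices. -}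

module Defs where

open import Data.Empty using (⊥)
open import Data.Fin using (Fin; zero; suc)
import Data.Fin.Properties as Fin
open import Data.Fin.Subset using (Side; Subset; inside; outside; _∈_; _∉_; _⊆_; _─_; ∣_∣)
open import Data.Fin.Subset.Properties using (_∈?_; _⊆?_)
open import Data.Integer using (+_)
open import Data.List as List using (List; []; _∷_; _∷ʳ_; length; filter; allFin; cartesianProductWith)
open import Data.List.Extrema.Nat using (max)
open import Data.List.Membership.Propositional using () renaming (_∈_ to _∈ˡ_)
open import Data.List.Membership.Propositional.Properties using (∈-lookup; ∈-cartesianProductWith⁺)
import Data.List.Membership.DecPropositional as DecMembership
open import Data.List.Relation.Unary.All as All using ()
open import Data.List.Relation.Unary.AllPairs using ([]; _∷_)
open import Data.List.Relation.Unary.Any using (here; there)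
open import Data.List.Relation.Unary.Linked using (Linked; linked?)
open import Data.List.Relation.Unary.Unique.Propositional using (Unique)
open import Data.List.Relation.Unary.Unique.DecPropositional using (unique?)
import Data.List.Relation.Unary.Unique.Propositional.Properties as Unique
open import Data.Nat as ℕ using (ℕ; zero; suc; z≤n; s≤s; _≤_; _<_)
open import Data.Nat.Divisibility using (_∣_)
open import Data.Product using (∃; _×_; _,_; proj₁)
open import Data.Rational as ℚ using (ℚ; 0ℚ; 1ℚ)
open import Data.Sum using (_⊎_; inj₁; inj₂)
open import Data.Vec using ([]; _∷_; here; there; head; tail; lookup)
import Data.Vec.Properties as Vec
open import Function using (_∘_)
open import Level using (0ℓ)
open import Relation.Binary using () renaming (Decidable to Decidable₂)
open import Relation.Binary.PropositionalEquality using (_≡_; refl; sym; cong; cong₂)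
open import Relation.Nullary using (Dec; yes; no; ¬_; contradiction)
open import Relation.Nullary.Decidable using (map′; _×-dec_; _⊎-dec_; _→-dec_)
open import Relation.Unary using (Pred; Decidable)

private
  variable
    n : ℕ

-- Simple undirected graphs on Fin n.  S ◁ G adds a new vertex zero with
-- neighbourhood S to G, whose vertices are shifted by suc.  Every simple graph
-- on Fin n has exactly one such description (see ofRelation and
-- neighbours-injective), so _≡_ on Graph n is equality of edge sets.

infixr 5 _◁_

data Graph : ℕ → Set where
  ∅   : Graph zero
  _◁_ : Subset n → Graph n → Graph (suc n)

neighbours : Graph n → Fin n → Subset n
neighbours (S ◁ G) zero    = outside ∷ S
neighbours (S ◁ G) (suc v) = lookup S v ∷ neighbours G v

Adjacent : Graph n → Fin n → Fin n → Set
Adjacent G u v = v ∈ neighbours G u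

adjacent? : (G : Graph n) → Decidable₂ (Adjacent G)
adjacent? G u v = v ∈? neighbours G u

Adjacent-irrefl : (G : Graph n) (v : Fin n) → ¬ Adjacent G v v
Adjacent-irrefl (S ◁ G) zero    ()
Adjacent-irrefl (S ◁ G) (suc v) (there p) = Adjacent-irrefl G v p

Adjacent-sym : (G : Graph n) (u v : Fin n) → Adjacent G u v → Adjacent G v u
Adjacent-sym (S ◁ G) zero    zero    p         = p
Adjacent-sym (S ◁ G) zero    (suc v) (there p) = Vec.lookup⇒[]= zero (lookup S v ∷ neighbours G v) (Vec.[]=⇒lookup p)
Adjacent-sym (S ◁ G) (suc u) zero    p         = there (Vec.lookup⇒[]= u S (Vec.[]=⇒lookup p))
Adjacent-sym (S ◁ G) (suc u) (suc v) (there p) = there (Adjacent-sym G u v p)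

-- The graph of a relation presented by f (u is related to v when v ∈ f u);
-- adjacency is the given relation whenever it is irreflexive and symmetric.
ofRelation : (Fin n → Subset n) → Graph n
ofRelation {zero}  f = ∅
ofRelation {suc n} f = tail (f zero) ◁ ofRelation (tail ∘ f ∘ suc)

private
  ∈⇒tail : {S : Subset (suc n)} {v : Fin n} → suc v ∈ S → v ∈ tail S
  ∈⇒tail (there p) = p

  tail⇒∈ : {S : Subset (suc n)} {v : Fin n} → v ∈ tail S → suc v ∈ S
  tail⇒∈ {S = x ∷ S} p = there p

ofRelation-adjacent⁺ : (f : Fin n → Subset n) → (∀ u → u ∉ f u) → (∀ u v → v ∈ f u → u ∈ f v) →
                       ∀ u v → v ∈ f u → Adjacent (ofRelation f) u v
ofRelation-adjacent⁺ f irr symm zero    zero    p = contradiction p (irr zero)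
ofRelation-adjacent⁺ f irr symm zero    (suc v) p = there (∈⇒tail p)
ofRelation-adjacent⁺ f irr symm (suc u) zero    p =
  Adjacent-sym (ofRelation f) zero (suc u) (there (∈⇒tail (symm (suc u) zero p)))
ofRelation-adjacent⁺ f irr symm (suc u) (suc v) p =
  there (ofRelation-adjacent⁺ (tail ∘ f ∘ suc) (λ w → irr (suc w) ∘ tail⇒∈)
    (λ a b → ∈⇒tail ∘ symm (suc a) (suc b) ∘ tail⇒∈) u v (∈⇒tail p))

ofRelation-adjacent⁻ : (f : Fin n → Subset n) → (∀ u v → v ∈ f u → u ∈ f v) →
                       ∀ u v → Adjacent (ofRelation f) u v → v ∈ f u
ofRelation-adjacent⁻ f symm zero    zero    ()
ofRelation-adjacent⁻ f symm zero    (suc v) (there p) = tail⇒∈ p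
ofRelation-adjacent⁻ f symm (suc u) zero    p
  with Adjacent-sym (ofRelation f) (suc u) zero p
... | there q = symm zero (suc u) (tail⇒∈ q)
ofRelation-adjacent⁻ f symm (suc u) (suc v) (there p) =
  tail⇒∈ (ofRelation-adjacent⁻ (tail ∘ f ∘ suc)
    (λ a b → ∈⇒tail ∘ symm (suc a) (suc b) ∘ tail⇒∈) u v p)

neighbours-injective : (G H : Graph n) → (∀ v → neighbours G v ≡ neighbours H v) → G ≡ H
neighbours-injective ∅       ∅       eq = refl
neighbours-injective (S ◁ G) (T ◁ H) eq =
  cong₂ _◁_ (Vec.∷-injectiveʳ (eq zero)) (neighbours-injective G H (λ v → Vec.∷-injectiveʳ (eq (suc v))))

degree : Graph n → Fin n → ℕ
degree G v = ∣ neighbours G v ∣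

Δ : Graph n → ℕ
Δ {n} G = max 0 (List.map (degree G) (allFin n))

Regular : ℕ → Pred (Graph n) 0ℓ
Regular d G = ∀ v → degree G v ≡ d

infix 4 _⊑_
infixl 6 _∖_

_⊑_ : Graph n → Graph n → Set
H ⊑ G = ∀ v → neighbours H v ⊆ neighbours G v

_∖_ : Graph n → Graph n → Graph n
∅       ∖ ∅       = ∅
(S ◁ G) ∖ (T ◁ H) = (S ─ T) ◁ (G ∖ H)

private
  lookup-─ : (S T : Subset n) (v : Fin n) →
             lookup (S ─ T) v ∷ [] ≡ (lookup S v ∷ []) ─ (lookup T v ∷ [])
  lookup-─ (_ ∷ S) (outside ∷ T) zero    = refl
  lookup-─ (_ ∷ S) (inside  ∷ T) zero    = refl
  lookup-─ (_ ∷ S) (_ ∷ T)       (suc v) = lookup-─ S T v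

neighbours-∖ : (G H : Graph n) (v : Fin n) → neighbours (G ∖ H) v ≡ neighbours G v ─ neighbours H v
neighbours-∖ (S ◁ G) (T ◁ H) zero    = refl
neighbours-∖ (S ◁ G) (T ◁ H) (suc v) =
  cong₂ _∷_ (cong head (lookup-─ S T v)) (neighbours-∖ G H v)

-- A cycle is listed by its vertices in cyclic order, the first one not repeated.
IsCycle : Graph n → Pred (List (Fin n)) 0ℓ
IsCycle G []       = ⊥
IsCycle G (v ∷ vs) = 3 ≤ length (v ∷ vs) × Unique (v ∷ vs) × Linked (Adjacent G) (v ∷ vs ∷ʳ v)

GraphProperty : Set₁
GraphProperty = ∀ {n} → Pred (Graph n) 0ℓ

Hamiltonian : GraphProperty
Hamiltonian G = ∃ λ c → IsCycle G c × ∀ v → v ∈ˡ c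

Resilient : ℕ → GraphProperty → GraphProperty
Resilient r P {n} G = (H : Graph n) → H ⊑ G → Δ H ≤ r → P (G ∖ H)

sides : List Side
sides = outside ∷ inside ∷ []

allSubsets : ∀ n → List (Subset n)
allSubsets zero    = [] ∷ []
allSubsets (suc n) = cartesianProductWith _∷_ sides (allSubsets n)

allGraphs : ∀ n → List (Graph n)
allGraphs zero    = ∅ ∷ []
allGraphs (suc n) = cartesianProductWith _◁_ (allSubsets n) (allGraphs n)

∈-allSubsets : (S : Subset n) → S ∈ˡ allSubsets n
∈-allSubsets []            = here refl
∈-allSubsets (outside ∷ S) = ∈-cartesianProductWith⁺ _∷_ {xs = sides} (here refl) (∈-allSubsets S)
∈-allSubsets (inside  ∷ S) = ∈-cartesianProductWith⁺ _∷_ {xs = sides} (there (here refl)) (∈-allSubsets S)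

sides-unique : Unique sides
sides-unique = ((λ ()) All.∷ All.[]) ∷ (All.[] ∷ [])

allSubsets-unique : ∀ n → Unique (allSubsets n)
allSubsets-unique zero    = All.[] ∷ []
allSubsets-unique (suc n) = Unique.cartesianProductWith⁺ _∷_ (λ { refl → refl , refl })
  sides-unique (allSubsets-unique n)

∈-allGraphs : (G : Graph n) → G ∈ˡ allGraphs n
∈-allGraphs ∅       = here refl
∈-allGraphs (S ◁ G) = ∈-cartesianProductWith⁺ _◁_ (∈-allSubsets S) (∈-allGraphs G)

allGraphs-unique : ∀ n → Unique (allGraphs n)
allGraphs-unique zero    = All.[] ∷ []
allGraphs-unique (suc n) = Unique.cartesianProductWith⁺ _◁_ (λ { refl → refl , refl })
  (allSubsets-unique n) (allGraphs-unique n)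

regular? : ∀ d → Decidable (Regular {n} d)
regular? d G = Fin.all? (λ v → degree G v ℕ.≟ d)

_⊑?_ : Decidable₂ (_⊑_ {n})
H ⊑? G = Fin.all? (λ v → neighbours H v ⊆? neighbours G v)

isCycle? : (G : Graph n) → Decidable (IsCycle G)
isCycle? G []       = no λ ()
isCycle? G (v ∷ vs) =
  3 ℕ.≤? length (v ∷ vs) ×-dec unique? Fin._≟_ (v ∷ vs) ×-dec linked? (adjacent? G) (v ∷ vs ∷ʳ v)

private
  anyList? : ∀ k {P : Pred (List (Fin n)) 0ℓ} → Decidable P → Dec (∃ λ xs → length xs ≤ k × P xs)
  anyList? zero    P? = map′ (λ p → [] , z≤n , p) (λ { ([] , _ , p) → p }) (P? [])
  anyList? (suc k) P? = map′
    (λ { (inj₁ p) → [] , z≤n , p ; (inj₂ (x , xs , l , p)) → x ∷ xs , s≤s l , p })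
    (λ { ([] , _ , p) → inj₁ p ; (x ∷ xs , s≤s l , p) → inj₂ (x , xs , l , p) })
    (P? [] ⊎-dec Fin.any? (λ x → anyList? k (P? ∘ (x ∷_))))

  lookup-injective : {xs : List (Fin n)} → Unique xs → ∀ {i j} → List.lookup xs i ≡ List.lookup xs j → i ≡ j
  lookup-injective (x∉ ∷ u) {zero}  {zero}  eq = refl
  lookup-injective (x∉ ∷ u) {zero}  {suc j} eq = contradiction eq (All.lookup x∉ (∈-lookup j))
  lookup-injective (x∉ ∷ u) {suc i} {zero}  eq = contradiction (sym eq) (All.lookup x∉ (∈-lookup i))
  lookup-injective (x∉ ∷ u) {suc i} {suc j} eq = cong suc (lookup-injective u eq)

  cycle-length : (G : Graph n) (c : List (Fin n)) → IsCycle G c → length c ≤ n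
  cycle-length G (v ∷ vs) (_ , u , _) = Fin.injective⇒≤ (lookup-injective u)

hamiltonian? : Decidable (Hamiltonian {n})
hamiltonian? {n} G = map′
  (λ { (c , _ , p) → c , p })
  (λ { (c , p) → c , cycle-length G c (proj₁ p) , p })
  (anyList? n (λ c → isCycle? G c ×-dec Fin.all? (λ v → DecMembership._∈?_ Fin._≟_ v c)))

allGraphs? : {P : Pred (Graph n) 0ℓ} → Decidable P → Dec (∀ G → P G)
allGraphs? {n} P? = map′ (λ ps G → All.lookup ps (∈-allGraphs G)) (λ f → All.universal f (allGraphs n))
  (All.all? P? (allGraphs n))

resilient? : ∀ r (P : GraphProperty) → (∀ {n} → Decidable (P {n})) → Decidable (Resilient r P {n})
resilient? r P P? G = allGraphs? (λ H → H ⊑? G →-dec (Δ H ℕ.≤? r →-dec P? (G ∖ H)))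

regularGraphs : ∀ n → ℕ → List (Graph n)
regularGraphs n d = filter (regular? d) (allGraphs n)

-- k / m, with the junk value 0 for m = 0.
ratio : ℕ → ℕ → ℚ
ratio k zero    = 0ℚ
ratio k (suc m) = + k ℚ./ suc m

-- The probability that G_{n,d} satisfies P.  The junk value of ratio is never
-- relevant below: d-regular graphs exist whenever d < n and n d is even.
Pr : ∀ n → ℕ → {P : Pred (Graph n) 0ℓ} → Decidable P → ℚ
Pr n d P? = ratio (length (filter P? (regularGraphs n d))) (length (regularGraphs n d))

-- G_{n,d} satisfies P a.a.s.: the probability tends to 1 as n → ∞ through the
-- n for which G_{n,d} is defined.
AlmostSurely : ℕ → (P : GraphProperty) → (∀ {n} → Decidable (P {n})) → Set
AlmostSurely d P P? =
  ∀ ε → 0ℚ ℚ.< ε → ∃ λ N → ∀ n → N ≤ n → d < n → 2 ∣ n ℕ.* d → ℚ.∣ Pr n d (P? {n}) ℚ.- 1ℚ ∣ ℚ.< ε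

{-# OPTIONS --safe #-}
module Submission where

-- Non-resilience is certified by a vertex set B with |B| > n/2 in which every
-- vertex has at most r = (d−1)/2 neighbours: deleting the edges inside B leaves
-- an independent set that is too large for a Hamilton cycle.  Both sides of a
-- locally maximal cut have inner degrees at most r, so if G is resilient, both
-- sides have exactly n/2 vertices.  Pick a vertex v outside such a half B.  For a
-- neighbour w of v in B, a switching that replaces edges vw and xy by vx and wy,
-- with x outside B, lowers the number of neighbours of v in B; after at most d of
-- them v can be added to B and the graph is not resilient.  The edge xy is taken
-- outside B if many such edges exist; otherwise most vertices of the other half
-- have inner degree below r, and with that half as B one can afford to give w and
-- some y in B one more inner neighbour.  Each step has linearly many choices of y,
-- and a graph arises by at most d²n switchings at v, so by double counting the
-- resilient graphs are at most a constant times as many as the other ones.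

open import Defs

open import Algebra.Properties.CommutativeSemigroup using (x∙yz≈y∙xz)
open import Data.Bool.Base using (true; false; not)
import Data.Bool.Properties as Bool
open import Data.Fin.Base using (Fin; zero; suc)
import Data.Fin.Properties as Fin
open import Data.Fin.Subset using (Subset; inside; outside; _∈_; _∉_; _⊆_; _∩_; _∪_; _─_; ∁; ⁅_⁆; ∣_∣)
open import Data.Fin.Subset.Properties
import Data.Integer.Base as ℤ
import Data.Integer.Properties as ℤ
open import Data.List.Base as List
  using (List; []; _∷_; _++_; _∷ʳ_; length; filter; allFin; tabulate; map; concatMap; cartesianProduct)
import Data.List.Extrema.Nat as Extrema
import Data.List.Membership.DecPropositional as DecMembership
open import Data.List.Membership.Propositional using () renaming (_∈_ to _∈ˡ_)
open import Data.List.Membership.Propositional.Properties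
import Data.List.Properties as List
open import Data.List.Relation.Unary.All as All using ()
import Data.List.Relation.Unary.All.Properties as All
open import Data.List.Relation.Unary.AllPairs using ([]; _∷_)
open import Data.List.Relation.Unary.Any as Any using (here; there)
open import Data.List.Relation.Unary.Linked using (Linked; _∷_)
open import Data.List.Relation.Unary.Unique.Propositional using (Unique)
import Data.List.Relation.Unary.Unique.Propositional.Properties as Unique
open import Data.Nat
  using (ℕ; zero; suc; _+_; _*_; _^_; _∸_; _/_; _%_; _≤_; _<_; _≤?_; _<?_; z≤n; s≤s; NonZero)
open import Data.Nat.Divisibility using (_∣_; m%n≡0⇒n∣m; ∣m⇒∣m*n; m∣m*n)
open import Data.Nat.DivMod using (m≡m%n+[m/n]*n; m%n<n; m*n/n≡m)
open import Data.Nat.Induction using (<-wellFounded)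
open import Data.Nat.ListAction using (sum)
open import Data.Nat.Properties hiding (_≟_; _≤?_; _<?_)
open import Data.Nat.Solver using (module +-*-Solver)
open import Data.Product.Base using (∃; _×_; _,_; proj₁; proj₂)
import Data.Rational.Base as ℚ
import Data.Rational.Properties as ℚ
import Data.Rational.Unnormalised.Base as ℚᵘ
import Data.Rational.Unnormalised.Properties as ℚᵘ
open import Data.Sum.Base as Sum using (_⊎_; inj₁; inj₂; [_,_]′)
open import Data.Unit.Base using (⊤; tt)
import Data.Vec.Base as Vec
import Data.Vec.Properties as Vec
open import Function.Base using (_∘_; id)
open import Induction.WellFounded using (Acc; acc)
open import Level using (0ℓ)
open import Relation.Binary.PropositionalEquality
  using (_≡_; _≢_; refl; sym; trans; cong; cong₂; subst; subst₂; module ≡-Reasoning)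
open import Relation.Nullary using (Dec; yes; no; ¬_; contradiction; does)
open import Relation.Nullary.Decidable
  using (¬?; map′; _×-dec_; _⊎-dec_; _→-dec_; dec-true; decidable-stable)
open import Relation.Unary using (Pred; Decidable)

private
  variable
    n : ℕ
    A B : Set

-- Counting in lists: injections and double counting.

length-≤-by : {xs : List A} {ys : List B} (Q : A → B → Set) → Unique xs →
              (∀ {x} → x ∈ˡ xs → ∃ λ y → y ∈ˡ ys × Q x y) →
              (∀ {x x′ y} → x ∈ˡ xs → x′ ∈ˡ xs → Q x y → Q x′ y → x ≡ x′) →
              length xs ≤ length ys
length-≤-by {xs = []}             Q u        f inj = z≤n
length-≤-by {xs = x ∷ xs} {ys} Q (x∉ ∷ u) f inj with f (here refl)
... | y , y∈ys , q with ∈-∃++ y∈ys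
...   | ys₁ , ys₂ , refl = begin
  suc (length xs)           ≤⟨ s≤s (length-≤-by Q u f′ (λ p p′ → inj (there p) (there p′))) ⟩
  suc (length (ys₁ ++ ys₂)) ≡⟨ List.length-++-sucʳ ys₁ y ys₂ ⟨
  length (ys₁ ++ y ∷ ys₂)   ∎
  where
  open ≤-Reasoning
  -- The match `y` of `x` is removed from `ys`. Since `Q` is injective and `x` does not recur, no
  -- later entry needs `y`, so the rest is matched within `ys₁ ++ ys₂`.
  f′ : ∀ {z} → z ∈ˡ xs → ∃ λ w → w ∈ˡ ys₁ ++ ys₂ × Q z w
  f′ z∈xs with f (there z∈xs)
  ... | w , w∈ , q′ with ∈-++⁻ ys₁ w∈
  ...   | inj₁ p           = w , ∈-++⁺ˡ p , q′
  ...   | inj₂ (here refl) = contradiction (inj (here refl) (there z∈xs) q q′) (All.lookup x∉ z∈xs)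
  ...   | inj₂ (there p)   = w , ∈-++⁺ʳ ys₁ p , q′

length-⊆ : {xs ys : List A} → Unique xs → (∀ {x} → x ∈ˡ xs → x ∈ˡ ys) → length xs ≤ length ys
length-⊆ u f = length-≤-by _≡_ u (λ p → _ , f p , refl) (λ _ _ → λ { refl refl → refl })

length-concatMap-≤ : (f : A → List B) (xs : List A) {k : ℕ} → (∀ x → length (f x) ≤ k) →
                     length (concatMap f xs) ≤ length xs * k
length-concatMap-≤ f []       h = z≤n
length-concatMap-≤ f (x ∷ xs) h =
  ≤-trans (≤-reflexive (List.length-++ (f x))) (+-mono-≤ (h x) (length-concatMap-≤ f xs h))

length-filter-split : {P : Pred A 0ℓ} (P? : Decidable P) (xs : List A) →
                      length (filter P? xs) + length (filter (λ x → ¬? (P? x)) xs) ≡ length xs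
length-filter-split P? []       = refl
length-filter-split P? (x ∷ xs) with P? x
... | yes _ = cong suc (length-filter-split P? xs)
... | no  _ = trans (+-suc _ _) (cong suc (length-filter-split P? xs))

module _ {R : A → B → Set} (R? : ∀ x y → Dec (R x y)) where

  private
    column : List A → B → ℕ
    column xs y = length (filter (λ x → R? x y) xs)

    row : List B → A → ℕ
    row ys x = length (filter (R? x) ys)

    rotate : ∀ a b c → a + (b + c) ≡ b + (a + c)
    rotate = x∙yz≈y∙xz +-commutativeSemigroup

    sum-column-∷ : ∀ x xs ys → sum (map (column (x ∷ xs)) ys) ≡ row ys x + sum (map (column xs) ys)
    sum-column-∷ x xs []       = refl
    sum-column-∷ x xs (y ∷ ys) with R? x y
    ... | yes _ = cong suc (trans (cong (column xs y +_) (sum-column-∷ x xs ys)) (rotate (column xs y) (row ys x) _))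
    ... | no  _ = trans (cong (column xs y +_) (sum-column-∷ x xs ys)) (rotate (column xs y) (row ys x) _)

    sum-columns-≤ : ∀ xs {k} ys → (∀ y → y ∈ˡ ys → column xs y ≤ k) → sum (map (column xs) ys) ≤ length ys * k
    sum-columns-≤ xs []       h = z≤n
    sum-columns-≤ xs (y ∷ ys) h = +-mono-≤ (h y (here refl)) (sum-columns-≤ xs ys (λ z → h z ∘ there))

    rows-≤-sum-columns : ∀ {m} xs ys → (∀ x → x ∈ˡ xs → m ≤ row ys x) → length xs * m ≤ sum (map (column xs) ys)
    rows-≤-sum-columns []       ys h = z≤n
    rows-≤-sum-columns (x ∷ xs) ys h = ≤-trans
      (+-mono-≤ (h x (here refl)) (rows-≤-sum-columns xs ys (λ z → h z ∘ there)))
      (≤-reflexive (sym (sum-column-∷ x xs ys)))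

  -- Both bounds concern the number of related pairs, kept as the sum of the column counts; a new
  -- entry `x` raises this sum by its row count.
  double-counting : ∀ {m k} xs ys →
                    (∀ x → x ∈ˡ xs → m ≤ length (filter (R? x) ys)) →
                    (∀ y → y ∈ˡ ys → length (filter (λ x → R? x y) xs) ≤ k) →
                    length xs * m ≤ length ys * k
  double-counting xs ys lower upper =
    ≤-trans (rows-≤-sum-columns xs ys lower) (sum-columns-≤ xs ys upper)

-- Subsets of `Fin n` and their cardinalities.

subset : {P : Pred (Fin n) 0ℓ} → Decidable P → Subset n
subset P? = Vec.tabulate (does ∘ P?)

module _ {P : Pred (Fin n) 0ℓ} (P? : Decidable P) where

  ∈-subset⁺ : ∀ {v} → P v → v ∈ subset P?
  ∈-subset⁺ {v} p = Vec.lookup⇒[]= v _ (trans (Vec.lookup∘tabulate _ v) (dec-true (P? v) p))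

  ∈-subset⁻ : ∀ {v} → v ∈ subset P? → P v
  ∈-subset⁻ {v} v∈ with P? v | trans (sym (Vec.lookup∘tabulate (does ∘ P?) v)) (Vec.[]=⇒lookup v∈)
  ... | yes p | _  = p
  ... | no _  | ()

elements : Subset n → List (Fin n)
elements {n} S = filter (_∈? S) (allFin n)

∈-elements⁺ : {S : Subset n} {v : Fin n} → v ∈ S → v ∈ˡ elements S
∈-elements⁺ {S = S} {v} = ∈-filter⁺ (_∈? S) (∈-allFin v)

∈-elements⁻ : {S : Subset n} {v : Fin n} → v ∈ˡ elements S → v ∈ S
∈-elements⁻ {S = S} = proj₂ ∘ ∈-filter⁻ (_∈? S) {xs = allFin _}

elements-unique : (S : Subset n) → Unique (elements S)
elements-unique {n} S = Unique.filter⁺ (_∈? S) (Unique.allFin⁺ n)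

private
  filter-suc : ∀ s (S : Subset n) xs →
               length (filter (_∈? (s Vec.∷ S)) (map suc xs)) ≡ length (filter (_∈? S) xs)
  filter-suc s S []       = refl
  filter-suc s S (x ∷ xs) with does (x ∈? S)
  ... | true  = cong suc (filter-suc s S xs)
  ... | false = filter-suc s S xs

  filter-tabulate-suc : ∀ s (S : Subset n) → length (filter (_∈? (s Vec.∷ S)) (tabulate suc)) ≡ length (elements S)
  filter-tabulate-suc s S = trans
    (cong (length ∘ filter (_∈? (s Vec.∷ S))) (sym (List.map-tabulate id suc)))
    (filter-suc s S (allFin _))

length-elements : (S : Subset n) → length (elements S) ≡ ∣ S ∣
length-elements Vec.[]      = refl
length-elements (inside  Vec.∷ S) = cong suc (trans (filter-tabulate-suc inside S) (length-elements S))
length-elements (outside Vec.∷ S) = trans (filter-tabulate-suc outside S) (length-elements S)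

card-≤ : (S : Subset n) (xs : List (Fin n)) → (∀ {v} → v ∈ S → v ∈ˡ xs) → ∣ S ∣ ≤ length xs
card-≤ S xs f = subst (_≤ length xs) (length-elements S) (length-⊆ (elements-unique S) (f ∘ ∈-elements⁻))

card-≥ : (S : Subset n) {xs : List (Fin n)} → Unique xs → (∀ {v} → v ∈ˡ xs → v ∈ S) → length xs ≤ ∣ S ∣
card-≥ S {xs} u f = subst (length xs ≤_) (length-elements S) (length-⊆ u (∈-elements⁺ ∘ f))

card-⊆ : (S T : Subset n) → (∀ {v} → v ∈ S → v ∈ T) → ∣ S ∣ ≤ ∣ T ∣
card-⊆ S T f = p⊆q⇒∣p∣≤∣q∣ f

card-insert : (S T : Subset n) (x : Fin n) → (∀ {v} → v ∈ S → v ≡ x ⊎ v ∈ T) → ∣ S ∣ ≤ suc ∣ T ∣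
card-insert S T x f = ≤-trans
  (card-≤ S (x ∷ elements T) ([ (λ { refl → here refl }) , there ∘ ∈-elements⁺ ]′ ∘ f))
  (≤-reflexive (cong suc (length-elements T)))

-- From `T` to `S` the element `w` is lost and at most `x` is gained. The neighbourhoods of the four
-- vertices of a switching change in this way.
card-exchange : (S T : Subset n) (w x : Fin n) → w ∈ T → w ∉ S →
                (∀ {v} → v ∈ S → v ≡ x ⊎ v ∈ T) → ∣ S ∣ ≤ ∣ T ∣
card-exchange S T w x w∈T w∉S f = ≤-pred (begin
  suc ∣ S ∣                      ≡⟨ cong suc (length-elements S) ⟨
  length (w ∷ elements S)
    ≤⟨ length-⊆ (All.tabulate (λ { p refl → w∉S (∈-elements⁻ p) }) ∷ elements-unique S) g ⟩
  length (x ∷ elements T)       ≡⟨ cong suc (length-elements T) ⟩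
  suc ∣ T ∣                      ∎)
  where
  open ≤-Reasoning
  g : ∀ {v} → v ∈ˡ w ∷ elements S → v ∈ˡ x ∷ elements T
  g (here refl) = there (∈-elements⁺ w∈T)
  g (there p)   = [ (λ { refl → here refl }) , there ∘ ∈-elements⁺ ]′ (f (∈-elements⁻ p))

∣p∣+∣∁p∣≡n : (p : Subset n) → ∣ p ∣ + ∣ ∁ p ∣ ≡ n
∣p∣+∣∁p∣≡n {n} p = trans (cong (∣ p ∣ +_) (∣∁p∣≡n∸∣p∣ p)) (m+[n∸m]≡n (∣p∣≤n p))

-- Equality of graphs, and graphs of decidable relations.

graph-ext : (G H : Graph n) → (∀ u v → Adjacent G u v → Adjacent H u v) →
            (∀ u v → Adjacent H u v → Adjacent G u v) → G ≡ H
graph-ext G H f g = neighbours-injective G H (λ v → ⊆-antisym (λ {u} → f v u) (λ {u} → g v u))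

_≟ᴳ_ : (G H : Graph n) → Dec (G ≡ H)
∅       ≟ᴳ ∅       = yes refl
(S ◁ G) ≟ᴳ (T ◁ H) = map′ (λ { (refl , refl) → refl }) (λ { refl → refl , refl })
  (Vec.≡-dec Bool._≟_ S T ×-dec (G ≟ᴳ H))

module _ {R : Fin n → Fin n → Set} (R? : ∀ u v → Dec (R u v)) where

  fromDec : Graph n
  fromDec = ofRelation (subset ∘ R?)

  module _ (R-sym : ∀ u v → R u v → R v u) where

    private
      symm : ∀ u v → v ∈ subset (R? u) → u ∈ subset (R? v)
      symm u v = ∈-subset⁺ (R? v) ∘ R-sym u v ∘ ∈-subset⁻ (R? u)

    adjacent-fromDec⁻ : ∀ u v → Adjacent fromDec u v → R u v
    adjacent-fromDec⁻ u v = ∈-subset⁻ (R? u) ∘ ofRelation-adjacent⁻ (subset ∘ R?) symm u v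

    adjacent-fromDec⁺ : (∀ u → ¬ R u u) → ∀ u v → R u v → Adjacent fromDec u v
    adjacent-fromDec⁺ irr u v =
      ofRelation-adjacent⁺ (subset ∘ R?) (λ u → irr u ∘ ∈-subset⁻ (R? u)) symm u v ∘ ∈-subset⁺ (R? u)

-- Sparse sets with more than half of the vertices refute resilience.

inside-degree : Graph n → Subset n → Fin n → ℕ
inside-degree G B u = ∣ neighbours G u ∩ B ∣

x∈p─q⇒x∉q : (p q : Subset n) {x : Fin n} → x ∈ p ─ q → x ∉ q
x∈p─q⇒x∉q (_ Vec.∷ p) (inside  Vec.∷ q) (Vec.there x∈) (Vec.there x∈q) = x∈p─q⇒x∉q p q x∈ x∈q
x∈p─q⇒x∉q (_ Vec.∷ p) (outside Vec.∷ q) (Vec.there x∈) (Vec.there x∈q) = x∈p─q⇒x∉q p q x∈ x∈q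

module _ (B : Subset n) {_~_ : Fin n → Fin n → Set} (indep : ∀ {u v} → u ~ v → u ∈ B → v ∉ B) where

  private
    #B : List (Fin n) → ℕ
    #B = length ∘ filter (_∈? B)

    edge-bound : ∀ {x y} → x ~ y → #B (x ∷ []) + #B (y ∷ []) ≤ 1
    edge-bound {x} {y} x~y with x ∈? B | y ∈? B
    ... | yes p | yes q = contradiction q (indep x~y p)
    ... | yes p | no  q = ≤-refl
    ... | no  p | yes q = ≤-refl
    ... | no  p | no  q = z≤n

    #B-∷ : ∀ x xs → #B (x ∷ xs) ≡ #B (x ∷ []) + #B xs
    #B-∷ x xs with x ∈? B
    ... | yes p = refl
    ... | no  p = refl

    -- The induction step for paths: `a` and `b` count the first two vertices, `c` and `l` are the
    -- count and the length of the path after its first vertex and before its end point, and `e`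
    -- counts the end point.
    arith : ∀ a b c l e → a + b ≤ 1 → 2 * c + e ≤ l + b → 2 * (a + c) + e ≤ suc l + a
    arith a b c l e h₁ h₂ = begin
      2 * (a + c) + e     ≡⟨ solve 3 (λ a c e → con 2 :* (a :+ c) :+ e := a :+ (a :+ (con 2 :* c :+ e))) refl a c e ⟩
      a + (a + (2 * c + e)) ≤⟨ +-monoʳ-≤ a (+-monoʳ-≤ a h₂) ⟩
      a + (a + (l + b))   ≡⟨ solve 3 (λ a l b → a :+ (a :+ (l :+ b)) := (a :+ b) :+ (l :+ a)) refl a l b ⟩
      (a + b) + (l + a)   ≤⟨ +-monoˡ-≤ (l + a) h₁ ⟩
      suc l + a           ∎
      where
      open ≤-Reasoning
      open import Data.Nat.Solver using (module +-*-Solver)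
      open +-*-Solver

  -- The correction terms at both ends cancel for closed paths.
  path-bound : ∀ x xs y → Linked _~_ (x ∷ xs ∷ʳ y) →
               2 * #B (x ∷ xs) + #B (y ∷ []) ≤ length (x ∷ xs) + #B (x ∷ [])
  path-bound x []        y (x~y ∷ _) = subst (λ k → 2 * k + #B (y ∷ []) ≤ 1 + #B (x ∷ [])) (sym (#B-∷ x []))
    (arith (#B (x ∷ [])) (#B (y ∷ [])) 0 0 (#B (y ∷ [])) (edge-bound x~y) ≤-refl)
  path-bound x (x′ ∷ xs) y (x~x′ ∷ l) = subst
    (λ k → 2 * k + #B (y ∷ []) ≤ suc (length (x′ ∷ xs)) + #B (x ∷ [])) (sym (#B-∷ x (x′ ∷ xs)))
    (arith (#B (x ∷ [])) (#B (x′ ∷ [])) (#B (x′ ∷ xs)) _ (#B (y ∷ [])) (edge-bound x~x′) (path-bound x′ xs y l))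

  closed-path-bound : ∀ v vs → Linked _~_ (v ∷ vs ∷ʳ v) → 2 * #B (v ∷ vs) ≤ length (v ∷ vs)
  closed-path-bound v vs l = +-cancelʳ-≤ (#B (v ∷ [])) _ _ (path-bound v vs v l)

-- Of two consecutive vertices on a cycle at most one lies in `B`, so `B` has at most half of the
-- entries of the cycle; a Hamilton cycle would have to contain all of `B`.
independent⇒¬hamiltonian : (G : Graph n) (B : Subset n) → n < 2 * ∣ B ∣ →
                           (∀ {u v} → Adjacent G u v → u ∈ B → v ∉ B) → ¬ Hamiltonian G
independent⇒¬hamiltonian {n} G B large indep (v ∷ vs , (_ , unique , linked) , covers) = <⇒≱ large (begin
  2 * ∣ B ∣                           ≡⟨ cong (2 *_) (length-elements B) ⟨
  2 * length (elements B)
    ≤⟨ *-monoʳ-≤ 2 (length-⊆ (elements-unique B) (λ p → ∈-filter⁺ (_∈? B) (covers _) (∈-elements⁻ p))) ⟩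
  2 * length (filter (_∈? B) (v ∷ vs)) ≤⟨ closed-path-bound B indep v vs linked ⟩
  length (v ∷ vs)                     ≤⟨ length-⊆ unique (λ _ → ∈-allFin _) ⟩
  length (allFin n)                   ≡⟨ List.length-tabulate id ⟩
  n                                   ∎)
  where open ≤-Reasoning

sparse-majority⇒¬resilient : (r : ℕ) (G : Graph n) (B : Subset n) → n < 2 * ∣ B ∣ →
                             (∀ {u} → u ∈ B → inside-degree G B u ≤ r) → ¬ Resilient r Hamiltonian G
sparse-majority⇒¬resilient {n} r G B large sparse resilient =
  independent⇒¬hamiltonian (G ∖ H) B large indep (resilient H H⊑G ΔH≤r)
  where
  R? : ∀ u v → Dec (Adjacent G u v × u ∈ B × v ∈ B)
  R? u v = adjacent? G u v ×-dec u ∈? B ×-dec v ∈? B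

  H : Graph n
  H = fromDec R?

  R-sym : ∀ u v → Adjacent G u v × u ∈ B × v ∈ B → Adjacent G v u × v ∈ B × u ∈ B
  R-sym u v (a , p , q) = Adjacent-sym G u v a , q , p

  H⊑G : H ⊑ G
  H⊑G u = proj₁ ∘ adjacent-fromDec⁻ R? R-sym u _

  degree-H : ∀ u → degree H u ≤ r
  degree-H u with u ∈? B
  ... | yes u∈B = ≤-trans
    (p⊆q⇒∣p∣≤∣q∣ λ p → let (a , _ , q) = adjacent-fromDec⁻ R? R-sym u _ p in x∈p∩q⁺ (a , q)) (sparse u∈B)
  ... | no  u∉B = ≤-trans
    (card-≤ (neighbours H u) [] λ p → contradiction (proj₁ (proj₂ (adjacent-fromDec⁻ R? R-sym u _ p))) u∉B) z≤n

  ΔH≤r : Δ H ≤ r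
  ΔH≤r = Extrema.max≤v⁺ z≤n (All.map⁺ (All.universal degree-H (allFin n)))

  indep : ∀ {u v} → Adjacent (G ∖ H) u v → u ∈ B → v ∉ B
  indep {u} {v} a u∈B v∈B = x∈p─q⇒x∉q _ (neighbours H u) a′
    (adjacent-fromDec⁺ R? R-sym (λ w → Adjacent-irrefl G w ∘ proj₁) u v (p─q⊆p _ _ a′ , u∈B , v∈B))
    where
    a′ : v ∈ neighbours G u ─ neighbours H u
    a′ = subst (v ∈_) (neighbours-∖ G H u) a

-- Locally maximal cuts.

∣p∣+∣q∣≤∣r∣ : (p q r : Subset n) → (∀ {x} → x ∈ p → x ∉ q) → p ⊆ r → q ⊆ r → ∣ p ∣ + ∣ q ∣ ≤ ∣ r ∣
∣p∣+∣q∣≤∣r∣ p q r disjoint p⊆r q⊆r = subst (_≤ ∣ r ∣)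
  (trans (List.length-++ (elements p)) (cong₂ _+_ (length-elements p) (length-elements q)))
  (card-≥ r (Unique.++⁺ (elements-unique p) (elements-unique q)
                            (λ (a , b) → disjoint (∈-elements⁻ a) (∈-elements⁻ b)))
            ([ p⊆r ∘ ∈-elements⁻ , q⊆r ∘ ∈-elements⁻ ]′ ∘ ∈-++⁻ (elements p)))

module _ (G : Graph n) where

  SameSide : Subset n → Fin n → Fin n → Set
  SameSide B u v = Vec.lookup B u ≡ Vec.lookup B v

  sameSide? : ∀ B u v → Dec (SameSide B u v)
  sameSide? B u v = Vec.lookup B u Bool.≟ Vec.lookup B v

  sameNeighbour? : ∀ B u → Decidable (λ v → Adjacent G u v × SameSide B u v)
  sameNeighbour? B u v = adjacent? G u v ×-dec sameSide? B u v

  crossNeighbour? : ∀ B u → Decidable (λ v → Adjacent G u v × ¬ SameSide B u v)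
  crossNeighbour? B u v = adjacent? G u v ×-dec ¬? (sameSide? B u v)

  sameNeighbours crossNeighbours : Subset n → Fin n → Subset n
  sameNeighbours  B u = subset (sameNeighbour? B u)
  crossNeighbours B u = subset (crossNeighbour? B u)

  private
    Mono : Subset n → Fin n × Fin n → Set
    Mono B (u , v) = Adjacent G u v × SameSide B u v

    mono? : ∀ B → Decidable (Mono B)
    mono? B (u , v) = adjacent? G u v ×-dec sameSide? B u v

    -- The potential of the local search. Pairs are ordered, so an edge within a side counts twice;
    -- `star` lists both orientations to match.
    monoPairs : Subset n → List (Fin n × Fin n)
    monoPairs B = filter (mono? B) (cartesianProduct (allFin n) (allFin n))

    ∈-monoPairs⁺ : ∀ B {e} → Mono B e → e ∈ˡ monoPairs B
    ∈-monoPairs⁺ B = ∈-filter⁺ (mono? B) (∈-cartesianProduct⁺ (∈-allFin _) (∈-allFin _))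

    ∈-monoPairs⁻ : ∀ B {e} → e ∈ˡ monoPairs B → Mono B e
    ∈-monoPairs⁻ B = proj₂ ∘ ∈-filter⁻ (mono? B) {xs = cartesianProduct (allFin n) (allFin n)}

    star : Fin n → Subset n → List (Fin n × Fin n)
    star u S = map (u ,_) (elements S) ++ map (_, u) (elements S)

    ∈-star⁺ˡ : ∀ {u v} S → v ∈ S → (u , v) ∈ˡ star u S
    ∈-star⁺ˡ {u} S v∈S = ∈-++⁺ˡ (∈-map⁺ (u ,_) (∈-elements⁺ v∈S))

    ∈-star⁺ʳ : ∀ {u v} S → v ∈ S → (v , u) ∈ˡ star u S
    ∈-star⁺ʳ {u} S v∈S = ∈-++⁺ʳ (map (u ,_) (elements S)) (∈-map⁺ (_, u) (∈-elements⁺ v∈S))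

    ∈-star⁻ : ∀ {u S e} → e ∈ˡ star u S → ∃ λ v → v ∈ S × (e ≡ (u , v) ⊎ e ≡ (v , u))
    ∈-star⁻ {u} {S} e∈ with ∈-++⁻ (map (u ,_) (elements S)) e∈
    ... | inj₁ p with ∈-map⁻ (u ,_) p
    ...   | v , v∈ , eq = v , ∈-elements⁻ v∈ , inj₁ eq
    ∈-star⁻ {u} {S} e∈ | inj₂ p with ∈-map⁻ (_, u) p
    ...   | v , v∈ , eq = v , ∈-elements⁻ v∈ , inj₂ eq

    length-star : ∀ u S → length (star u S) ≡ ∣ S ∣ + ∣ S ∣
    length-star u S = trans (List.length-++ (map (u ,_) (elements S)))
      (cong₂ _+_ (trans (List.length-map (u ,_) (elements S)) (length-elements S))
                 (trans (List.length-map (_, u) (elements S)) (length-elements S)))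

    star-unique : ∀ u S → u ∉ S → Unique (star u S)
    star-unique u S u∉S = Unique.++⁺
      (Unique.map⁺ (λ { refl → refl }) (elements-unique S))
      (Unique.map⁺ (λ { refl → refl }) (elements-unique S))
      disjoint
      where
      disjoint : ∀ {e} → e ∈ˡ map (u ,_) (elements S) × e ∈ˡ map (_, u) (elements S) → _
      disjoint (p , q) with ∈-map⁻ (u ,_) p | ∈-map⁻ (_, u) q
      ... | _ , v∈ , refl | _ , _ , refl = u∉S (∈-elements⁻ v∈)

  module _ (B : Subset n) (u : Fin n) where

    private
      B′ : Subset n
      B′ = Vec.updateAt B u not

      adjacent⇒≢ : ∀ {v} → Adjacent G u v → v ≢ u
      adjacent⇒≢ a refl = Adjacent-irrefl G u a

      at-u : Vec.lookup B′ u ≡ not (Vec.lookup B u)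
      at-u = Vec.lookup∘updateAt u B

      off-u : ∀ {v} → v ≢ u → Vec.lookup B′ v ≡ Vec.lookup B v
      off-u v≢u = Vec.lookup∘updateAt′ _ u v≢u B

      flipped : ∀ {v} → Adjacent G u v → SameSide B′ u v → ¬ SameSide B u v
      flipped a s t = Bool.not-¬ (sym t) (trans (sym (off-u (adjacent⇒≢ a))) (trans (sym s) at-u))

      disjoint : ∀ {e} → e ∈ˡ monoPairs B′ × e ∈ˡ star u (sameNeighbours B u) → _
      disjoint (p , q) with ∈-monoPairs⁻ B′ p | ∈-star⁻ q
      ... | a , s | v , v∈ , inj₁ refl = flipped a s (proj₂ (∈-subset⁻ (sameNeighbour? B u) v∈))
      ... | a , s | v , v∈ , inj₂ refl =
        flipped (Adjacent-sym G v u a) (sym s) (proj₂ (∈-subset⁻ (sameNeighbour? B u) v∈))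

      covered-mono : ∀ e → e ∈ˡ monoPairs B′ → e ∈ˡ monoPairs B ++ star u (crossNeighbours B u)
      covered-mono (v , w) p with ∈-monoPairs⁻ B′ p | v Fin.≟ u | w Fin.≟ u
      ... | a , s | yes refl | _        =
        ∈-++⁺ʳ (monoPairs B) (∈-star⁺ˡ (crossNeighbours B u)
          (∈-subset⁺ (crossNeighbour? B u) (a , flipped a s)))
      ... | a , s | no _     | yes refl =
        let a′ = Adjacent-sym G v w a in
        ∈-++⁺ʳ (monoPairs B) (∈-star⁺ʳ (crossNeighbours B u)
          (∈-subset⁺ (crossNeighbour? B u) (a′ , flipped a′ (sym s))))
      ... | a , s | no v≢u   | no w≢u   = ∈-++⁺ˡ (∈-monoPairs⁺ B (a , trans (sym (off-u v≢u)) (trans s (off-u w≢u))))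

      covered-star : ∀ {e} → e ∈ˡ star u (sameNeighbours B u) → e ∈ˡ monoPairs B
      covered-star p with ∈-star⁻ p
      ... | v , v∈ , inj₁ refl = ∈-monoPairs⁺ B (∈-subset⁻ (sameNeighbour? B u) v∈)
      ... | v , v∈ , inj₂ refl =
        let (a , s) = ∈-subset⁻ (sameNeighbour? B u) v∈ in ∈-monoPairs⁺ B (Adjacent-sym G u v a , sym s)

    -- Moving `u` exchanges its two kinds of neighbours. The proof avoids subtraction: the new pairs
    -- and the star of the old same-side neighbours are disjoint, and together they lie in the old
    -- pairs plus the star of the old cross neighbours.
    flip-decreases : ∣ crossNeighbours B u ∣ < ∣ sameNeighbours B u ∣ → length (monoPairs B′) < length (monoPairs B)
    flip-decreases lt = +-cancelʳ-< _ _ _ (begin-strict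
      length (monoPairs B′) + (c + c) <⟨ +-monoʳ-< (length (monoPairs B′)) (+-mono-< lt lt) ⟩
      length (monoPairs B′) + (s + s)
        ≡⟨ trans (List.length-++ (monoPairs B′)) (cong (length (monoPairs B′) +_) (length-star u _)) ⟨
      length (monoPairs B′ ++ star u (sameNeighbours B u))
        ≤⟨ length-⊆ unique ([ covered-mono _ , ∈-++⁺ˡ ∘ covered-star ]′ ∘ ∈-++⁻ (monoPairs B′)) ⟩
      length (monoPairs B ++ star u (crossNeighbours B u))
        ≡⟨ trans (List.length-++ (monoPairs B)) (cong (length (monoPairs B) +_) (length-star u _)) ⟩
      length (monoPairs B) + (c + c)  ∎)
      where
      open ≤-Reasoning
      c = ∣ crossNeighbours B u ∣
      s = ∣ sameNeighbours B u ∣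
      unique : Unique (monoPairs B′ ++ star u (sameNeighbours B u))
      unique = Unique.++⁺
        (Unique.filter⁺ (mono? B′) (Unique.cartesianProduct⁺ (Unique.allFin⁺ n) (Unique.allFin⁺ n)))
        (star-unique u _ (λ p → Adjacent-irrefl G u (proj₁ (∈-subset⁻ (sameNeighbour? B u) p))))
        disjoint

  LocallyMaximal : Subset n → Set
  LocallyMaximal B = ∀ u → ∣ sameNeighbours B u ∣ ≤ ∣ crossNeighbours B u ∣

  -- As long as some vertex has more neighbours on its own side than across, it is moved; by
  -- `flip-decreases` the search terminates.
  locallyMaximalCut : ∃ LocallyMaximal
  locallyMaximalCut = improve (Vec.replicate n outside) (<-wellFounded _)
    where
    improve : ∀ B → Acc _<_ (length (monoPairs B)) → ∃ LocallyMaximal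
    improve B (acc rec) with Fin.all? (λ u → ∣ sameNeighbours B u ∣ ≤? ∣ crossNeighbours B u ∣)
    ... | yes p = B , p
    ... | no ¬p with Fin.¬∀⟶∃¬ n _ (λ u → ∣ sameNeighbours B u ∣ ≤? ∣ crossNeighbours B u ∣) ¬p
    ...   | u , ¬q = improve (Vec.updateAt B u not) (rec (flip-decreases B u (≰⇒> ¬q)))

  degree-split : ∀ B u → ∣ sameNeighbours B u ∣ + ∣ crossNeighbours B u ∣ ≤ degree G u
  degree-split B u = ∣p∣+∣q∣≤∣r∣ (sameNeighbours B u) (crossNeighbours B u) _
    (λ p q → proj₂ (∈-subset⁻ (crossNeighbour? B u) q) (proj₂ (∈-subset⁻ (sameNeighbour? B u) p)))
    (proj₁ ∘ ∈-subset⁻ (sameNeighbour? B u))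
    (proj₁ ∘ ∈-subset⁻ (crossNeighbour? B u))

-- In a locally maximal cut, twice the number of same-side neighbours is at most the degree
-- `2 * r + 1`, so that number is at most `r`.
sparseBipartition : (r : ℕ) (G : Graph n) → Regular (suc (2 * r)) G →
  ∃ λ B → (∀ {u} → u ∈ B → inside-degree G B u ≤ r) × (∀ {u} → u ∈ ∁ B → inside-degree G (∁ B) u ≤ r)
sparseBipartition {n} r G regular with locallyMaximalCut G
... | B , maximal = B , (λ u∈B → bound _ _ λ v∈B → trans (Vec.[]=⇒lookup u∈B) (sym (Vec.[]=⇒lookup v∈B)))
                      , (λ u∉B → bound _ _ λ v∉B → trans (∉⇒lookup u∉B) (sym (∉⇒lookup v∉B)))
  where
  ∉⇒lookup : ∀ {u} → u ∈ ∁ B → Vec.lookup B u ≡ outside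
  ∉⇒lookup {u} u∈ = Bool.not-injective (trans (sym (Vec.lookup-map u not B)) (Vec.[]=⇒lookup u∈))

  same≤r : ∀ u → ∣ sameNeighbours G B u ∣ ≤ r
  same≤r u = ≮⇒≥ λ r<s → <-irrefl refl (begin-strict
    suc (2 * r)                                           <⟨ n<1+n _ ⟩
    suc (suc (2 * r))                                     ≡⟨ *-suc 2 r ⟨
    2 * suc r                                             ≤⟨ *-monoʳ-≤ 2 r<s ⟩
    2 * ∣ sameNeighbours G B u ∣                          ≡⟨ cong (∣ sameNeighbours G B u ∣ +_) (+-identityʳ _) ⟩
    ∣ sameNeighbours G B u ∣ + ∣ sameNeighbours G B u ∣  ≤⟨ +-monoʳ-≤ _ (maximal u) ⟩
    ∣ sameNeighbours G B u ∣ + ∣ crossNeighbours G B u ∣ ≤⟨ degree-split G B u ⟩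
    degree G u                                            ≡⟨ regular u ⟩
    suc (2 * r)                                           ∎)
    where open ≤-Reasoning

  bound : ∀ u C → (∀ {v} → v ∈ C → SameSide G B u v) → inside-degree G C u ≤ r
  bound u C f = ≤-trans
    (card-⊆ (neighbours G u ∩ C) (sameNeighbours G B u)
      λ p → let (a , c) = x∈p∩q⁻ _ _ p in ∈-subset⁺ (sameNeighbour? G B u) (a , f c))
    (same≤r u)

-- Switchings: replacing two edges by two others.

Edge : Fin n → Fin n → Fin n → Fin n → Set
Edge a b u z = (u ≡ a × z ≡ b) ⊎ (u ≡ b × z ≡ a)

TwoEdges : Fin n → Fin n → Fin n → Fin n → Fin n → Fin n → Set
TwoEdges a b c d u z = Edge a b u z ⊎ Edge c d u z

twoEdges? : (a b c d u z : Fin n) → Dec (TwoEdges a b c d u z)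
twoEdges? a b c d u z = edge? a b ⊎-dec edge? c d
  where
  edge? : ∀ a b → Dec (Edge a b u z)
  edge? a b = (u Fin.≟ a ×-dec z Fin.≟ b) ⊎-dec (u Fin.≟ b ×-dec z Fin.≟ a)

twoEdges-sym : {a b c d : Fin n} → ∀ u z → TwoEdges a b c d u z → TwoEdges a b c d z u
twoEdges-sym u z = Sum.map flip flip
  where
  flip : ∀ {a b} → Edge a b u z → Edge a b z u
  flip (inj₁ (p , q)) = inj₂ (q , p)
  flip (inj₂ (p , q)) = inj₁ (q , p)

module _ (G : Graph n) (v w x y : Fin n) where

  Switched : Fin n → Fin n → Set
  Switched u z = (Adjacent G u z × ¬ TwoEdges v w x y u z) ⊎ TwoEdges v x w y u z

  switched? : ∀ u z → Dec (Switched u z)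
  switched? u z = (adjacent? G u z ×-dec ¬? (twoEdges? v w x y u z)) ⊎-dec twoEdges? v x w y u z

  switched-sym : ∀ u z → Switched u z → Switched z u
  switched-sym u z = Sum.map (λ (a , ¬t) → Adjacent-sym G u z a , ¬t ∘ twoEdges-sym z u) (twoEdges-sym u z)

  switch : Graph n
  switch = fromDec switched?

  -- Four of the six inequalities between the vertices follow from the adjacencies (`v≢w`, `x≢y`,
  -- `w≢x`, `v≢y` below), so only two are fields.
  record Switchable : Set where
    field
      vw   : Adjacent G v w
      xy   : Adjacent G x y
      ¬vx  : ¬ Adjacent G v x
      ¬wy  : ¬ Adjacent G w y
      v≢x  : v ≢ x
      w≢y  : w ≢ y

module _ {G : Graph n} {v w x y : Fin n} where

  switch⁻ : ∀ {u z} → Adjacent (switch G v w x y) u z → Switched G v w x y u z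
  switch⁻ = adjacent-fromDec⁻ (switched? G v w x y) (switched-sym G v w x y) _ _

  module _ (ok : Switchable G v w x y) where
    open Switchable ok

    switch⁺ : ∀ {u z} → Switched G v w x y u z → Adjacent (switch G v w x y) u z
    switch⁺ = adjacent-fromDec⁺ (switched? G v w x y) (switched-sym G v w x y) irr _ _
      where
      irr : ∀ u → ¬ Switched G v w x y u u
      irr u (inj₁ (a , _))                    = Adjacent-irrefl G u a
      irr u (inj₂ (inj₁ (inj₁ (refl , p)))) = v≢x p
      irr u (inj₂ (inj₁ (inj₂ (refl , p)))) = v≢x (sym p)
      irr u (inj₂ (inj₂ (inj₁ (refl , p)))) = w≢y p
      irr u (inj₂ (inj₂ (inj₂ (refl , p)))) = w≢y (sym p)

    v≢w : v ≢ w
    v≢w refl = Adjacent-irrefl G v vw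

    x≢y : x ≢ y
    x≢y refl = Adjacent-irrefl G x xy

    w≢x : w ≢ x
    w≢x refl = ¬vx vw

    v≢y : v ≢ y
    v≢y refl = ¬wy (Adjacent-sym G v w vw)

    -- Undoing a switching is again a switching at `v`, with `w` and `x` exchanged. Every one-sided
    -- bound therefore yields its converse.
    switchable-reverse : Switchable (switch G v w x y) v x w y
    switchable-reverse = record
      { vw  = switch⁺ (inj₂ (inj₁ (inj₁ (refl , refl))))
      ; xy  = switch⁺ (inj₂ (inj₂ (inj₁ (refl , refl))))
      ; ¬vx = ¬vw′ ∘ switch⁻
      ; ¬wy = ¬xy′ ∘ switch⁻
      ; v≢x = v≢w
      ; w≢y = x≢y
      }
      where
      ¬vw′ : ¬ Switched G v w x y v w
      ¬vw′ (inj₁ (_ , ¬t))                = ¬t (inj₁ (inj₁ (refl , refl)))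
      ¬vw′ (inj₂ (inj₁ (inj₁ (_ , p)))) = w≢x p
      ¬vw′ (inj₂ (inj₁ (inj₂ (p , _)))) = v≢x p
      ¬vw′ (inj₂ (inj₂ (inj₁ (p , _)))) = v≢w p
      ¬vw′ (inj₂ (inj₂ (inj₂ (p , _)))) = v≢y p

      ¬xy′ : ¬ Switched G v w x y x y
      ¬xy′ (inj₁ (_ , ¬t))                = ¬t (inj₂ (inj₁ (refl , refl)))
      ¬xy′ (inj₂ (inj₁ (inj₁ (p , _)))) = v≢x (sym p)
      ¬xy′ (inj₂ (inj₁ (inj₂ (_ , p)))) = v≢y (sym p)
      ¬xy′ (inj₂ (inj₂ (inj₁ (p , _)))) = w≢x (sym p)
      ¬xy′ (inj₂ (inj₂ (inj₂ (p , _)))) = x≢y p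

    edges⇒adjacent : ∀ {u z} → TwoEdges v w x y u z → Adjacent G u z
    edges⇒adjacent (inj₁ (inj₁ (refl , refl))) = vw
    edges⇒adjacent (inj₁ (inj₂ (refl , refl))) = Adjacent-sym G v w vw
    edges⇒adjacent (inj₂ (inj₁ (refl , refl))) = xy
    edges⇒adjacent (inj₂ (inj₂ (refl , refl))) = Adjacent-sym G x y xy

    adjacent⇒¬new : ∀ {u z} → Adjacent G u z → ¬ TwoEdges v x w y u z
    adjacent⇒¬new a (inj₁ (inj₁ (refl , refl))) = ¬vx a
    adjacent⇒¬new a (inj₁ (inj₂ (refl , refl))) = ¬vx (Adjacent-sym G x v a)
    adjacent⇒¬new a (inj₂ (inj₁ (refl , refl))) = ¬wy a
    adjacent⇒¬new a (inj₂ (inj₂ (refl , refl))) = ¬wy (Adjacent-sym G y w a)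

  switch-involutive : Switchable G v w x y → switch (switch G v w x y) v x w y ≡ G
  switch-involutive ok = graph-ext _ G from to
    where
    G′ : Graph n
    G′ = switch G v w x y

    from : ∀ u z → Adjacent (switch G′ v x w y) u z → Adjacent G u z
    from u z a with adjacent-fromDec⁻ (switched? G′ v x w y) (switched-sym G′ v x w y) u z a
    ... | inj₂ t = edges⇒adjacent ok t
    ... | inj₁ (b , ¬t) with switch⁻ b
    ...   | inj₁ (c , _) = c
    ...   | inj₂ t       = contradiction t ¬t

    to : ∀ u z → Adjacent G u z → Adjacent (switch G′ v x w y) u z
    to u z a = adjacent-fromDec⁺ (switched? G′ v x w y) (switched-sym G′ v x w y) irr u z sw
      where
      irr : ∀ u → ¬ Switched G′ v x w y u u
      irr u (inj₁ (b , _)) = Adjacent-irrefl G′ u b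
      irr u (inj₂ t)       = Adjacent-irrefl G u (edges⇒adjacent ok t)
      sw : Switched G′ v x w y u z
      sw with twoEdges? v w x y u z
      ... | yes t = inj₂ t
      ... | no ¬t = inj₁ (switch⁺ ok (inj₁ (a , ¬t)) , adjacent⇒¬new ok a)

  module _ (ok : Switchable G v w x y) where
    open Switchable ok

    adjacent-switch-v : ∀ {z} → Adjacent (switch G v w x y) v z → z ≡ x ⊎ Adjacent G v z
    adjacent-switch-v a with switch⁻ a
    ... | inj₁ (b , _)                = inj₂ b
    ... | inj₂ (inj₁ (inj₁ (_ , p))) = inj₁ p
    ... | inj₂ (inj₁ (inj₂ (p , _))) = contradiction p v≢x
    ... | inj₂ (inj₂ (inj₁ (p , _))) = contradiction p (v≢w ok)
    ... | inj₂ (inj₂ (inj₂ (p , _))) = contradiction p (v≢y ok)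

    adjacent-switch-w : ∀ {z} → Adjacent (switch G v w x y) w z → z ≡ y ⊎ Adjacent G w z
    adjacent-switch-w a with switch⁻ a
    ... | inj₁ (b , _)                = inj₂ b
    ... | inj₂ (inj₁ (inj₁ (p , _))) = contradiction (sym p) (v≢w ok)
    ... | inj₂ (inj₁ (inj₂ (p , _))) = contradiction p (w≢x ok)
    ... | inj₂ (inj₂ (inj₁ (_ , p))) = inj₁ p
    ... | inj₂ (inj₂ (inj₂ (p , _))) = contradiction p w≢y

    adjacent-switch-x : ∀ {z} → Adjacent (switch G v w x y) x z → z ≡ v ⊎ Adjacent G x z
    adjacent-switch-x a with switch⁻ a
    ... | inj₁ (b , _)                = inj₂ b
    ... | inj₂ (inj₁ (inj₁ (p , _))) = contradiction (sym p) v≢x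
    ... | inj₂ (inj₁ (inj₂ (_ , p))) = inj₁ p
    ... | inj₂ (inj₂ (inj₁ (p , _))) = contradiction (sym p) (w≢x ok)
    ... | inj₂ (inj₂ (inj₂ (p , _))) = contradiction p (x≢y ok)

    adjacent-switch-y : ∀ {z} → Adjacent (switch G v w x y) y z → z ≡ w ⊎ Adjacent G y z
    adjacent-switch-y a with switch⁻ a
    ... | inj₁ (b , _)                = inj₂ b
    ... | inj₂ (inj₁ (inj₁ (p , _))) = contradiction (sym p) (v≢y ok)
    ... | inj₂ (inj₁ (inj₂ (p , _))) = contradiction (sym p) (x≢y ok)
    ... | inj₂ (inj₂ (inj₁ (p , _))) = contradiction (sym p) w≢y
    ... | inj₂ (inj₂ (inj₂ (_ , p))) = inj₁ p

    adjacent-switch-other : ∀ {u z} → u ≢ v → u ≢ w → u ≢ x → u ≢ y →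
                            Adjacent (switch G v w x y) u z → Adjacent G u z
    adjacent-switch-other u≢v u≢w u≢x u≢y a with switch⁻ a
    ... | inj₁ (b , _)                = b
    ... | inj₂ (inj₁ (inj₁ (p , _))) = contradiction p u≢v
    ... | inj₂ (inj₁ (inj₂ (p , _))) = contradiction p u≢x
    ... | inj₂ (inj₂ (inj₁ (p , _))) = contradiction p u≢w
    ... | inj₂ (inj₂ (inj₂ (p , _))) = contradiction p u≢y

    degree-switch-≤ : ∀ u → degree (switch G v w x y) u ≤ degree G u
    degree-switch-≤ u with u Fin.≟ v | u Fin.≟ w | u Fin.≟ x | u Fin.≟ y
    ... | yes refl | _ | _ | _ =
      card-exchange _ _ w x vw (Switchable.¬vx (switchable-reverse ok)) adjacent-switch-v
    ... | no _ | yes refl | _ | _ =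
      card-exchange _ _ v y (Adjacent-sym G v w vw)
        (Switchable.¬vx (switchable-reverse ok) ∘ Adjacent-sym _ w v) adjacent-switch-w
    ... | no _ | no _ | yes refl | _ =
      card-exchange _ _ y v xy (Switchable.¬wy (switchable-reverse ok)) adjacent-switch-x
    ... | no _ | no _ | no _ | yes refl =
      card-exchange _ _ x w (Adjacent-sym G x y xy)
        (Switchable.¬wy (switchable-reverse ok) ∘ Adjacent-sym _ y x) adjacent-switch-y
    ... | no u≢v | no u≢w | no u≢x | no u≢y = card-⊆ _ _ (adjacent-switch-other u≢v u≢w u≢x u≢y)

-- No degree increases, because each of the four vertices trades an old neighbour for at most one
-- new one. The reverse switching restores `G`, so no degree decreases either.
degree-switch : {G : Graph n} {v w x y : Fin n} → Switchable G v w x y →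
                ∀ u → degree (switch G v w x y) u ≡ degree G u
degree-switch {G = G} {v} {w} {x} {y} ok u = ≤-antisym (degree-switch-≤ ok u)
  (subst (λ H → degree H u ≤ degree (switch G v w x y) u) (switch-involutive ok)
    (degree-switch-≤ (switchable-reverse ok) u))

-- Absorbing a vertex into a half by switchings.

-- The switching partner y is taken outside B (outer) or in B with room for one
-- more inner neighbour (inner).
data Mode : Set where
  outer inner : Mode

module _ (r m : ℕ) where

  Usable : Mode → Graph n → Subset n → Pred (Fin n) 0ℓ
  Usable outer G B y = y ∉ B × ∃ λ x → Adjacent G y x × x ∉ B
  Usable inner G B y = y ∈ B × inside-degree G B y < r

  usable? : ∀ k (G : Graph n) B → Decidable (Usable k G B)
  usable? outer G B y = ¬? (y ∈? B) ×-dec Fin.any? λ x → adjacent? G y x ×-dec ¬? (x ∈? B)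
  usable? inner G B y = y ∈? B ×-dec inside-degree G B y <? r

  -- In inner mode `w` receives the inner neighbour `y`, so every candidate for `w` must be below
  -- the bound `r`. In outer mode `w` trades `v` for another vertex outside `B`, and its inner
  -- degree does not grow.
  Slack : Mode → Graph n → Subset n → Fin n → Set
  Slack outer G B v = ⊤
  Slack inner G B v = ∀ w → Adjacent G v w → w ∈ B → inside-degree G B w < r

  slack? : ∀ k (G : Graph n) B v → Dec (Slack k G B v)
  slack? outer G B v = yes tt
  slack? inner G B v = Fin.all? λ w → adjacent? G v w →-dec (w ∈? B →-dec inside-degree G B w <? r)

  -- B can be enlarged by v after at most j switchings; each of them uses up to
  -- three of the usable vertices, whence the term 3 * j.
  record Absorbs (k : Mode) (j : ℕ) (G : Graph n) (v : Fin n) (B : Subset n) : Set where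
    field
      v∉B    : v ∉ B
      half   : n ≤ 2 * ∣ B ∣
      sparse : ∀ u → u ∈ B → inside-degree G B u ≤ r
      few    : inside-degree G B v ≤ j
      rich   : m + 3 * j ≤ ∣ subset (usable? k G B) ∣
      slack  : Slack k G B v

  absorbs? : ∀ k j (G : Graph n) v B → Dec (Absorbs k j G v B)
  absorbs? {n} k j G v B = map′
    (λ (a , b , c , d , e , f) → record { v∉B = a ; half = b ; sparse = c ; few = d ; rich = e ; slack = f })
    (λ s → let open Absorbs s in v∉B , half , sparse , few , rich , slack)
    (¬? (v ∈? B) ×-dec n ≤? 2 * ∣ B ∣ ×-dec Fin.all? (λ u → u ∈? B →-dec inside-degree G B u ≤? r)
      ×-dec inside-degree G B v ≤? j ×-dec m + 3 * j ≤? ∣ subset (usable? k G B) ∣ ×-dec slack? k G B v)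

  Absorbable : ℕ → Graph n → Fin n → Set
  Absorbable {n} j G v = ∃ λ (B : Subset n) → Absorbs outer j G v B ⊎ Absorbs inner j G v B

  absorbable? : ∀ j (G : Graph n) v → Dec (Absorbable j G v)
  absorbable? j G v = anySubset? λ B → absorbs? outer j G v B ⊎-dec absorbs? inner j G v B

  -- For `j = 0` the vertex `v` has no neighbour in `B`, so adding it raises no inner degree, while
  -- the set grows beyond half of the vertices.
  absorbable-0⇒¬resilient : (G : Graph n) (v : Fin n) → Absorbable 0 G v → ¬ Resilient r Hamiltonian G
  absorbable-0⇒¬resilient {n} G v (B , s) =
    [ absorb , absorb ]′ s
    where
    absorb : ∀ {k} → Absorbs k 0 G v B → ¬ Resilient r Hamiltonian G
    absorb s = sparse-majority⇒¬resilient r G (B ∪ ⁅ v ⁆) large sparse′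
      where
      open Absorbs s
      open ≤-Reasoning

      large : n < 2 * ∣ B ∪ ⁅ v ⁆ ∣
      large = begin-strict
        n                  ≤⟨ half ⟩
        2 * ∣ B ∣          <⟨ *-monoʳ-< 2 (p⊂q⇒∣p∣<∣q∣ (p⊆p∪q {p = B} ⁅ v ⁆ , v , x∈p∪q⁺ (inj₂ (x∈⁅x⁆ v)) , v∉B)) ⟩
        2 * ∣ B ∪ ⁅ v ⁆ ∣  ∎

      isolated : ∀ {u} → u ∈ B → ¬ Adjacent G v u
      isolated {u} u∈B a = <⇒≱
        (card-≥ (neighbours G v ∩ B) {u ∷ []} (All.[] ∷ []) λ { (here refl) → x∈p∩q⁺ (a , u∈B) }) few
        where
        import Data.List.Relation.Unary.All as All
        open import Data.List.Relation.Unary.AllPairs using ([]; _∷_)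

      shrink : ∀ {u z} → u ∈ B ∪ ⁅ v ⁆ → z ∈ neighbours G u ∩ (B ∪ ⁅ v ⁆) → z ∈ neighbours G u ∩ B
      shrink {u} {z} u∈ z∈ with x∈p∩q⁻ (neighbours G u) _ z∈
      ... | a , z∈′ with x∈p∪q⁻ B ⁅ v ⁆ z∈′
      ...   | inj₁ z∈B = x∈p∩q⁺ (a , z∈B)
      ...   | inj₂ z∈v with x∈⁅y⁆⇒x≡y v z∈v | x∈p∪q⁻ B ⁅ v ⁆ u∈
      ...     | refl | inj₁ u∈B = contradiction (Adjacent-sym G u v a) (isolated u∈B)
      ...     | refl | inj₂ u∈v with x∈⁅y⁆⇒x≡y v u∈v
      ...       | refl = contradiction a (Adjacent-irrefl G v)

      sparse′ : ∀ {u} → u ∈ B ∪ ⁅ v ⁆ → inside-degree G (B ∪ ⁅ v ⁆) u ≤ r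
      sparse′ {u} u∈ = ≤-trans (card-⊆ _ (neighbours G u ∩ B) (shrink u∈)) bound
        where
        bound : inside-degree G B u ≤ r
        bound with x∈p∪q⁻ B ⁅ v ⁆ u∈
        ... | inj₁ u∈B = sparse u u∈B
        ... | inj₂ u∈v with x∈⁅y⁆⇒x≡y v u∈v
        ...   | refl = ≤-trans few z≤n

  module _ {G : Graph n} {v w x y : Fin n} {B : Subset n} (ok : Switchable G v w x y)
           (v∉B : v ∉ B) (w∈B : w ∈ B) (x∉B : x ∉ B) where
    open Switchable ok

    private
      G′ = switch G v w x y
      ok′ = switchable-reverse ok

      ∩B : ∀ {u z a} → (Adjacent G′ u z → z ≡ a ⊎ Adjacent G u z) →
           z ∈ neighbours G′ u ∩ B → z ≡ a ⊎ z ∈ neighbours G u ∩ B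
      ∩B f p = let (a , b) = x∈p∩q⁻ _ _ p in Sum.map₂ (λ c → x∈p∩q⁺ (c , b)) (f a)

      absorb-≢ : ∀ {z a} {P : Set} → z ∈ B → a ∉ B → z ≡ a ⊎ P → P
      absorb-≢ z∈B a∉B (inj₁ refl) = contradiction z∈B a∉B
      absorb-≢ z∈B a∉B (inj₂ p)    = p

    -- The inner neighbour `w` is lost, and the new neighbour `x` lies outside `B`.
    inside-degree-switch-v : inside-degree G′ B v < inside-degree G B v
    inside-degree-switch-v = p⊂q⇒∣p∣<∣q∣
      ( (λ p → absorb-≢ (proj₂ (x∈p∩q⁻ (neighbours G′ v) _ p)) x∉B (∩B (adjacent-switch-v ok) p))
      , w , x∈p∩q⁺ (vw , w∈B) , Switchable.¬vx ok′ ∘ proj₁ ∘ x∈p∩q⁻ (neighbours G′ v) _ )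

    inside-degree-switch-w : inside-degree G′ B w ≤ suc (inside-degree G B w)
    inside-degree-switch-w = card-insert _ _ y (∩B (adjacent-switch-w ok))

    inside-degree-switch-w-∉ : y ∉ B → inside-degree G′ B w ≤ inside-degree G B w
    inside-degree-switch-w-∉ y∉B = card-⊆ _ _ λ p →
      absorb-≢ (proj₂ (x∈p∩q⁻ (neighbours G′ w) _ p)) y∉B (∩B (adjacent-switch-w ok) p)

    inside-degree-switch-y : inside-degree G′ B y ≤ suc (inside-degree G B y)
    inside-degree-switch-y = card-insert _ _ w (∩B (adjacent-switch-y ok))

    inside-degree-switch-other : ∀ {u} → u ∈ B → u ≢ w → u ≢ y → inside-degree G′ B u ≤ inside-degree G B u
    inside-degree-switch-other {u} u∈B u≢w u≢y = card-⊆ _ _ λ p → let (a , b) = x∈p∩q⁻ (neighbours G′ u) _ p in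
      x∈p∩q⁺ (adjacent-switch-other ok (λ { refl → v∉B u∈B }) u≢w (λ { refl → x∉B u∈B }) u≢y a , b)

    module _ (¬vy : ¬ Adjacent G v y) {j : ℕ} where

      absorbs-switch : ∀ k → Absorbs k (suc j) G v B → inside-degree G B v ≡ suc j → Usable k G B y →
                       Absorbs k j G′ v B
      absorbs-switch k s eq usable = record
        { v∉B    = v∉B
        ; half   = half
        ; sparse = λ u → sparse′ k s usable u
        ; few    = ≤-pred (subst (inside-degree G′ B v <_) eq inside-degree-switch-v)
        ; rich   = rich′
        ; slack  = slack′ k s
        }
        where
        open Absorbs s using (half; rich)
        open ≤-Reasoning

        sparse′ : ∀ k → Absorbs k (suc j) G v B → Usable k G B y → ∀ u → u ∈ B → inside-degree G′ B u ≤ r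
        sparse′ k s us u u∈B with u Fin.≟ w | u Fin.≟ y
        sparse′ outer s (y∉B , _)   u u∈B | yes refl | _ =
          ≤-trans (inside-degree-switch-w-∉ y∉B) (Absorbs.sparse s w w∈B)
        sparse′ inner s us          u u∈B | yes refl | _ =
          ≤-trans inside-degree-switch-w (Absorbs.slack s w vw w∈B)
        sparse′ outer s (y∉B , _)   u u∈B | no _     | yes refl =
          contradiction u∈B y∉B
        sparse′ inner s (_ , y<r)   u u∈B | no _     | yes refl =
          ≤-trans inside-degree-switch-y y<r
        sparse′ k     s us          u u∈B | no u≢w   | no u≢y =
          ≤-trans (inside-degree-switch-other u∈B u≢w u≢y) (Absorbs.sparse s u u∈B)

        slack′ : ∀ k → Absorbs k (suc j) G v B → Slack k G′ B v
        slack′ outer s = tt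
        -- Only `w` and `y` can gain inner neighbours. The former is no longer adjacent to `v`, and
        -- by `¬vy` the latter never was, so the remaining inner neighbours of `v` keep their slack.
        slack′ inner s z a z∈B = ≤-<-trans (inside-degree-switch-other z∈B z≢w z≢y) (Absorbs.slack s z b z∈B)
          where
          b : Adjacent G v z
          b = absorb-≢ z∈B x∉B (adjacent-switch-v ok a)
          z≢w : z ≢ w
          z≢w refl = Switchable.¬vx ok′ a
          z≢y : z ≢ y
          z≢y refl = ¬vy b

        -- In outer mode the edge from `u` to `z` is deleted only if `u` is `x` or `y`, as `z`
        -- outside `B` excludes the edge from `v` to `w`. In inner mode only the inner degrees of
        -- `w` and `y` may rise.
        survives : ∀ k {u} → Usable k G B u → u ≡ y ⊎ u ≡ w ⊎ u ≡ x ⊎ Usable k G′ B u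
        survives k {u} us with u Fin.≟ y | u Fin.≟ w | u Fin.≟ x
        survives k     us | yes p | _ | _ = inj₁ p
        survives k     us | no _ | yes p | _ = inj₂ (inj₁ p)
        survives k     us | no _ | no _ | yes p = inj₂ (inj₂ (inj₁ p))
        survives outer {u} (u∉B , z , a , z∉B) | no u≢y | no u≢w | no u≢x =
          inj₂ (inj₂ (inj₂ (u∉B , z , switch⁺ ok (inj₁ (a , kept)) , z∉B)))
          where
          kept : ¬ TwoEdges v w x y u z
          kept (inj₁ (inj₁ (_ , refl))) = z∉B w∈B
          kept (inj₁ (inj₂ (p , _)))    = u≢w p
          kept (inj₂ (inj₁ (p , _)))    = u≢x p
          kept (inj₂ (inj₂ (p , _)))    = u≢y p
        survives inner (u∈B , lt) | no u≢y | no u≢w | no u≢x =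
          inj₂ (inj₂ (inj₂ (u∈B , ≤-<-trans (inside-degree-switch-other u∈B u≢w u≢y) lt)))

        rich′ : m + 3 * j ≤ ∣ subset (usable? k G′ B) ∣
        rich′ = +-cancelˡ-≤ 3 _ _ (begin
          3 + (m + 3 * j)                               ≡⟨ x∙yz≈y∙xz +-commutativeSemigroup 3 m (3 * j) ⟩
          m + (3 + 3 * j)                               ≡⟨ cong (m +_) (*-suc 3 j) ⟨
          m + 3 * suc j                                 ≤⟨ rich ⟩
          ∣ subset (usable? k G B) ∣
            ≤⟨ card-≤ _ (y ∷ w ∷ x ∷ elements (subset (usable? k G′ B))) covered ⟩
          3 + length (elements (subset (usable? k G′ B))) ≡⟨ cong (3 +_) (length-elements (subset (usable? k G′ B))) ⟩
          3 + ∣ subset (usable? k G′ B) ∣               ∎)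
          where
          covered : ∀ {u} → u ∈ subset (usable? k G B) → u ∈ˡ y ∷ w ∷ x ∷ elements (subset (usable? k G′ B))
          covered u∈ with survives k (∈-subset⁻ (usable? k G B) u∈)
          ... | inj₁ refl               = here refl
          ... | inj₂ (inj₁ refl)        = there (here refl)
          ... | inj₂ (inj₂ (inj₁ refl)) = there (there (here refl))
          ... | inj₂ (inj₂ (inj₂ us))   = there (there (there (∈-elements⁺ (∈-subset⁺ (usable? k G′ B) us))))

-- Counting the switchings at a vertex.

∈-concatMap-intro : {A B : Set} (f : A → List B) {xs : List A} {x : A} {y : B} →
                    x ∈ˡ xs → y ∈ˡ f x → y ∈ˡ concatMap f xs
∈-concatMap-intro f x∈ y∈ = ∈-concatMap⁺ f (Any.map (λ { refl → y∈ }) x∈)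

nbrs : Graph n → Fin n → List (Fin n)
nbrs G u = elements (neighbours G u)

length-nbrs : ∀ {d} (G : Graph n) → Regular d G → ∀ u → length (nbrs G u) ≡ d
length-nbrs G reg u = trans (length-elements (neighbours G u)) (reg u)

-- Contains every graph from which a switching at `v` leads to `G`: in `G`, `x` is a neighbour of
-- `v` and `y` one of `w`, while `w` is free. Since only an upper bound is wanted, the list may also
-- contain other graphs.
switchPreimages : Fin n → Graph n → List (Graph n)
switchPreimages {n} v G =
  concatMap (λ x → concatMap (λ w → map (λ y → switch G v x w y) (nbrs G w)) (allFin n)) (nbrs G v)

length-switchPreimages : ∀ {d} (G : Graph n) → Regular d G → ∀ v → length (switchPreimages v G) ≤ d * (n * d)
length-switchPreimages {n} {d} G reg v = begin
  length (switchPreimages v G)  ≤⟨ length-concatMap-≤ _ (nbrs G v) (λ x → ≤-trans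
                                     (length-concatMap-≤ _ (allFin n) (λ w → ≤-reflexive
                                       (trans (List.length-map _ (nbrs G w)) (length-nbrs G reg w))))
                                     (≤-reflexive (cong (_* d) (List.length-tabulate {n = n} id)))) ⟩
  length (nbrs G v) * (n * d)   ≡⟨ cong (_* (n * d)) (length-nbrs G reg v) ⟩
  d * (n * d)                   ∎
  where open ≤-Reasoning

∈-switchPreimages : {G : Graph n} {v w x y : Fin n} → Switchable G v w x y →
                    G ∈ˡ switchPreimages v (switch G v w x y)
∈-switchPreimages {G = G} {v} {w} {x} {y} ok =
  ∈-concatMap-intro _ (∈-elements⁺ (Switchable.vw ok′))
    (∈-concatMap-intro _ (∈-allFin w)
      (subst (_∈ˡ map (λ y′ → switch G′ v x w y′) (nbrs G′ w)) (switch-involutive ok)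
        (∈-map⁺ (λ y′ → switch G′ v x w y′) (∈-elements⁺ (Switchable.xy ok′)))))
  where
  G′ = switch G v w x y
  ok′ = switchable-reverse ok

-- Outside this list, y and any neighbour x of y yield a simple graph after
-- switching, and y is not adjacent to v.
closeTo : Graph n → Fin n → Fin n → List (Fin n)
closeTo G v w = v ∷ w ∷ nbrs G v ++ nbrs G w ++ concatMap (nbrs G) (nbrs G v)

length-closeTo : ∀ {d} (G : Graph n) → Regular d G → ∀ v w → length (closeTo G v w) ≤ 2 + (d + (d + d * d))
length-closeTo {d = d} G reg v w = s≤s (s≤s (begin
  length (nbrs G v ++ nbrs G w ++ second)                    ≡⟨ List.length-++ (nbrs G v) ⟩
  length (nbrs G v) + length (nbrs G w ++ second)
    ≡⟨ cong₂ _+_ (length-nbrs G reg v) (List.length-++ (nbrs G w)) ⟩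
  d + (length (nbrs G w) + length second)
    ≡⟨ cong (λ k → d + (k + length second)) (length-nbrs G reg w) ⟩
  d + (d + length second)                                    ≤⟨ +-monoʳ-≤ d (+-monoʳ-≤ d
    (length-concatMap-≤ (nbrs G) (nbrs G v) (≤-reflexive ∘ length-nbrs G reg))) ⟩
  d + (d + length (nbrs G v) * d)                            ≡⟨ cong (λ k → d + (d + k * d)) (length-nbrs G reg v) ⟩
  d + (d + d * d)                                            ∎))
  where
  open ≤-Reasoning
  second = concatMap (nbrs G) (nbrs G v)

-- Comparing the numbers of graphs absorbable with `j + 1` and with `j` switchings.

regularGraphs-unique : ∀ n d → Unique (regularGraphs n d)
regularGraphs-unique n d = Unique.filter⁺ (regular? d) (allGraphs-unique n)

∈-regularGraphs⁺ : ∀ {d} {G : Graph n} → Regular d G → G ∈ˡ regularGraphs n d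
∈-regularGraphs⁺ {d = d} {G} = ∈-filter⁺ (regular? d) (∈-allGraphs G)

∈-regularGraphs⁻ : ∀ {d} {G : Graph n} → G ∈ˡ regularGraphs n d → Regular d G
∈-regularGraphs⁻ {n} {d} = proj₂ ∘ ∈-filter⁻ (regular? d) {xs = allGraphs n}

count-⊎ : {A : Set} {P Q R : Pred A 0ℓ} (P? : Decidable P) (Q? : Decidable Q) (R? : Decidable R) {xs : List A} →
          Unique xs → (∀ {x} → P x → Q x ⊎ R x) →
          length (filter P? xs) ≤ length (filter Q? xs) + length (filter R? xs)
count-⊎ {P = P} {Q} P? Q? R? {xs} u f = ≤-trans
  (length-⊆ (Unique.filter⁺ P? u) g) (≤-reflexive (List.length-++ (filter Q? xs)))
  where
  g : ∀ {x} → x ∈ˡ filter P? xs → x ∈ˡ filter Q? xs ++ filter R? xs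
  g p with ∈-filter⁻ P? {xs = xs} p
  ... | x∈ , px = [ ∈-++⁺ˡ ∘ ∈-filter⁺ Q? x∈ , ∈-++⁺ʳ (filter Q? xs) ∘ ∈-filter⁺ R? x∈ ]′ (f px)

-- For `n = q * s`, at most `d * (n * d)` switchings lead into a graph and at least `s` lead out of
-- one, so the quotient is `d * (q * d)`. The successor accounts for graphs that are absorbable with
-- fewer switchings already.
growthFactor : ℕ → ℕ → ℕ
growthFactor d q = suc (d * (q * d))

module _ (n r s : ℕ) (d : ℕ) (r<d : r < d) where

  private
    open DecMembership (Fin._≟_ {n}) using (_∉?_)
    open DecMembership (_≟ᴳ_ {n}) using () renaming (_∈?_ to _∈ᴳ?_)

    -- The summand after `s` bounds the length of `closeTo`, so `s` partners remain once the close
    -- ones are discarded.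
    m : ℕ
    m = s + (2 + (d + (d + d * d)))

    Gs : List (Graph n)
    Gs = regularGraphs n d

    absorbableAt? : ∀ j (v : Fin n) (G : Graph n) → Dec (Absorbable r m j G v)
    absorbableAt? j v G = absorbable? r m j G v

    -- For such graphs `v` has exactly `j + 1` neighbours in any witnessing `B`; otherwise
    -- `absorbs-pred` would make `j` switchings suffice.
    exact? : ∀ j (v : Fin n) → Decidable (λ G → Absorbable r m (suc j) G v × ¬ Absorbable r m j G v)
    exact? j v G = absorbableAt? (suc j) v G ×-dec ¬? (absorbableAt? j v G)

    -- In inner mode fewer than `r < d` of the `d` neighbours of `y` lie in `B`, so one lies outside
    -- and can serve as `x`.
    usable⇒edge : ∀ k {G : Graph n} {B y} → Regular d G → Usable r m k G B y → ∃ λ x → Adjacent G y x × x ∉ B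
    usable⇒edge outer reg (_ , e) = e
    usable⇒edge inner {G} {B} {y} reg (_ , lt) with Fin.any? (λ x → adjacent? G y x ×-dec ¬? (x ∈? B))
    ... | yes e = e
    ... | no ¬e = contradiction (<-trans lt r<d) (≤⇒≯ (subst (_≤ inside-degree G B y) (reg y)
                    (card-⊆ (neighbours G y) (neighbours G y ∩ B)
                      (λ {z} a → x∈p∩q⁺ (a , decidable-stable (z ∈? B) (λ z∉B → ¬e (z , a , z∉B)))))))

    absorbs-pred : ∀ k {j} {G : Graph n} {v B} → Absorbs r m k (suc j) G v B → inside-degree G B v ≤ j →
                   Absorbs r m k j G v B
    absorbs-pred k {j} s few′ = record
      { v∉B = v∉B ; half = half ; sparse = sparse ; few = few′ ; slack = slack
      ; rich = ≤-trans (+-monoʳ-≤ m (*-monoʳ-≤ 3 (n≤1+n j))) rich }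
      where open Absorbs s

    absorbs⇒absorbable : ∀ k {j} {G : Graph n} {v B} → Absorbs r m k j G v B → Absorbable r m j G v
    absorbs⇒absorbable outer s = _ , inj₁ s
    absorbs⇒absorbable inner s = _ , inj₂ s

    inside-nbr : ∀ {j} {G : Graph n} {B v} → inside-degree G B v ≡ suc j → ∃ λ w → Adjacent G v w × w ∈ B
    inside-nbr {G = G} {B} {v} eq with Fin.any? (λ w → adjacent? G v w ×-dec w ∈? B)
    ... | yes e = e
    ... | no ¬e = contradiction
      (subst (_≤ 0) eq (card-≤ (neighbours G v ∩ B) [] λ p → contradiction (_ , x∈p∩q⁻ _ _ p) ¬e)) λ ()

    module Step {k j} {G : Graph n} {v B} (reg : Regular d G) (st : Absorbs r m k (suc j) G v B)
             (eq : inside-degree G B v ≡ suc j) {w} (vw : Adjacent G v w) (w∈B : w ∈ B) where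
      open Absorbs st

      far : List (Fin n)
      far = filter (_∉? closeTo G v w) (elements (subset (usable? r m k G B)))

      s≤far : s ≤ length far
      s≤far = +-cancelʳ-≤ (2 + (d + (d + d * d))) s (length far) (begin
        m                                           ≤⟨ m≤m+n m _ ⟩
        m + 3 * suc j                               ≤⟨ rich ⟩
        ∣ subset (usable? r m k G B) ∣              ≡⟨ length-elements (subset (usable? r m k G B)) ⟨
        length us                                   ≡⟨ length-filter-split (_∉? closeTo G v w) us ⟨
        length far + length close                   ≤⟨ +-monoʳ-≤ (length far)
            (≤-trans (length-⊆ close-unique close⊆) (length-closeTo G reg v w)) ⟩
        length far + (2 + (d + (d + d * d)))        ∎)
        where
        open ≤-Reasoning
        us = elements (subset (usable? r m k G B))
        close = filter (λ y → ¬? (y ∉? closeTo G v w)) us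
        close-unique : Unique close
        close-unique = Unique.filter⁺ (λ y → ¬? (y ∉? closeTo G v w)) (elements-unique (subset (usable? r m k G B)))
        close⊆ : ∀ {y} → y ∈ˡ close → y ∈ˡ closeTo G v w
        close⊆ {y} p = decidable-stable (DecMembership._∈?_ Fin._≟_ y (closeTo G v w))
          (proj₂ (∈-filter⁻ (λ y → ¬? (y ∉? closeTo G v w)) {xs = us} p))

      Q : Fin n → Graph n → Set
      Q y G′ = ∃ λ x → Switchable G v w x y × G′ ≡ switch G v w x y

      target : ∀ {y} → y ∈ˡ far → ∃ λ G′ → (Regular d G′ × Absorbable r m j G′ v × G ∈ˡ switchPreimages v G′) ×
                                        Q y G′
      target {y} y∈ with ∈-filter⁻ (_∉? closeTo G v w) {xs = elements (subset (usable? r m k G B))} y∈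
      ... | y∈us , y∉close with ∈-subset⁻ (usable? r m k G B) (∈-elements⁻ {S = subset (usable? r m k G B)} y∈us)
      ...   | us with usable⇒edge k reg us
      ...     | x , yx , x∉B = switch G v w x y
        , ( (λ u → trans (degree-switch ok u) (reg u))
          , absorbs⇒absorbable k (absorbs-switch r m ok v∉B w∈B x∉B ¬vy k st eq us)
          , ∈-switchPreimages ok)
        , x , ok , refl
        where
        ¬vy : ¬ Adjacent G v y
        ¬vy a = y∉close (there (there (∈-++⁺ˡ (∈-elements⁺ a))))
        ok : Switchable G v w x y
        ok = record
          { vw  = vw
          ; xy  = Adjacent-sym G y x yx
          -- If `v` were adjacent to `x`, then `y` would be a neighbour of a neighbour of `v`.
          ; ¬vx = λ a → y∉close (there (there (∈-++⁺ʳ (nbrs G v) (∈-++⁺ʳ (nbrs G w)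
                    (∈-concatMap-intro (nbrs G) (∈-elements⁺ a) (∈-elements⁺ (Adjacent-sym G y x yx)))))))
          ; ¬wy = λ a → y∉close (there (there (∈-++⁺ʳ (nbrs G v) (∈-++⁺ˡ (∈-elements⁺ a)))))
          ; v≢x = λ { refl → ¬vy (Adjacent-sym G y v yx) }
          ; w≢y = λ { refl → y∉close (there (here refl)) }
          }

      -- The resulting graph determines `y` as the one new neighbour of `w`. Hence different
      -- partners give different graphs, whichever `x` is chosen for each of them.
      Q-injective : ∀ {y y′ G′} → Q y G′ → Q y′ G′ → y ≡ y′
      Q-injective {y} (x , ok , refl) (x′ , ok′ , eq′)
        with adjacent-switch-w ok′ (subst (λ H → Adjacent H w y) eq′ (Switchable.xy (switchable-reverse ok)))
      ... | inj₁ p = p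
      ... | inj₂ a = contradiction a (Switchable.¬wy ok)

      s≤targets : s ≤ length (filter (λ G′ → G ∈ᴳ? switchPreimages v G′) (filter (absorbableAt? j v) Gs))
      s≤targets = ≤-trans s≤far (length-≤-by Q
        (Unique.filter⁺ (_∉? closeTo G v w) (elements-unique (subset (usable? r m k G B))))
        (λ y∈ → let (G′ , (reg′ , ab , pre) , q) = target y∈ in
          G′ , ∈-filter⁺ (λ G′ → G ∈ᴳ? switchPreimages v G′)
                 (∈-filter⁺ (absorbableAt? j v) (∈-regularGraphs⁺ reg′) ab) pre , q)
        (λ _ _ → Q-injective))

    many-targets : ∀ j v G → G ∈ˡ filter (exact? j v) Gs →
                   s ≤ length (filter (λ G′ → G ∈ᴳ? switchPreimages v G′) (filter (absorbableAt? j v) Gs))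
    many-targets j v G G∈ with ∈-filter⁻ (exact? j v) {xs = Gs} G∈
    ... | G∈Gs , (B , ab) , ¬ab = [ go outer , go inner ]′ ab
      where
      reg : Regular d G
      reg = ∈-regularGraphs⁻ G∈Gs
      go : ∀ k → Absorbs r m k (suc j) G v B → _
      go k st with m≤n⇒m<n∨m≡n (Absorbs.few st)
      ... | inj₁ lt = contradiction (absorbs⇒absorbable k (absorbs-pred k st (≤-pred lt))) ¬ab
      ... | inj₂ eq with inside-nbr {G = G} {B} {v} eq
      ...   | w , vw , w∈B = Step.s≤targets reg st eq vw w∈B

    -- The pairs counted are those of a graph `G` and a graph `G′` with `G` among its preimages: at
    -- least `s` for each `G`, at most `d * (n * d)` for each `G′`.
    exact-bound : ∀ j v → length (filter (exact? j v) Gs) * s ≤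
                         length (filter (absorbableAt? j v) Gs) * (d * (n * d))
    exact-bound j v = double-counting (λ G G′ → G ∈ᴳ? switchPreimages v G′)
      (filter (exact? j v) Gs) (filter (absorbableAt? j v) Gs)
      (many-targets j v)
      (λ G′ G′∈ → ≤-trans
        (length-⊆ (Unique.filter⁺ _ (Unique.filter⁺ (exact? j v) (regularGraphs-unique n d)))
          (λ p → proj₂ (∈-filter⁻ (λ G → G ∈ᴳ? switchPreimages v G′) {xs = filter (exact? j v) Gs} p)))
        (length-switchPreimages G′ (∈-regularGraphs⁻ (proj₁ (∈-filter⁻ (absorbableAt? j v) {xs = Gs} G′∈))) v))

  module _ (q : ℕ) .{{_ : NonZero s}} (n≡qs : n ≡ q * s) where

    private
      growth : ℕ
      growth = growthFactor d q

    absorbable-suc : ∀ j v → length (filter (absorbableAt? (suc j) v) Gs) ≤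
                         length (filter (absorbableAt? j v) Gs) * growth
    absorbable-suc j v = begin
      length (filter (absorbableAt? (suc j) v) Gs)
        ≤⟨ count-⊎ (absorbableAt? (suc j) v) (absorbableAt? j v) (exact? j v) (regularGraphs-unique n d) split ⟩
      a + length (filter (exact? j v) Gs)
        -- Because `n = q * s`, the factor `s` cancels and a factor independent of `s` remains.
        ≤⟨ +-monoʳ-≤ a (*-cancelʳ-≤ _ _ s (≤-trans (exact-bound j v) (≤-reflexive arith))) ⟩
      a + a * (d * (q * d))
        ≡⟨ *-suc a (d * (q * d)) ⟨
      a * growth
        ∎
      where
      open ≤-Reasoning
      a = length (filter (absorbableAt? j v) Gs)
      split : ∀ {G} → Absorbable r m (suc j) G v →
              Absorbable r m j G v ⊎ (Absorbable r m (suc j) G v × ¬ Absorbable r m j G v)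
      split {G} p with absorbableAt? j v G
      ... | yes q = inj₁ q
      ... | no ¬q = inj₂ (p , ¬q)
      arith : a * (d * (n * d)) ≡ a * (d * (q * d)) * s
      arith = trans (cong (λ n → a * (d * (n * d))) n≡qs)
        (solve 4 (λ a d q s → a :* (d :* (q :* s :* d)) := a :* (d :* (q :* d)) :* s) refl a d q s)
        where open +-*-Solver

    -- Descends through `absorbable-suc` to `j = 0`, where absorbable graphs are not resilient.
    absorbable-bound : ∀ j v → length (filter (absorbableAt? j v) Gs) ≤
                         length (filter (λ G → ¬? (resilient? r Hamiltonian hamiltonian? G)) Gs) * growth ^ j
    absorbable-bound zero v = ≤-trans
      (length-⊆ (Unique.filter⁺ (absorbableAt? 0 v) (regularGraphs-unique n d))
        (λ {G} p → let (G∈ , ab) = ∈-filter⁻ (absorbableAt? 0 v) {xs = Gs} p in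
          ∈-filter⁺ (λ G → ¬? (resilient? r Hamiltonian hamiltonian? G)) G∈ (absorbable-0⇒¬resilient r m G v ab)))
      (≤-reflexive (sym (*-identityʳ _)))
    absorbable-bound (suc j) v = begin
      length (filter (absorbableAt? (suc j) v) Gs)     ≤⟨ absorbable-suc j v ⟩
      length (filter (absorbableAt? j v) Gs) * growth  ≤⟨ *-monoˡ-≤ growth (absorbable-bound j v) ⟩
      N * growth ^ j * growth               ≡⟨ *-assoc N (growth ^ j) growth ⟩
      N * (growth ^ j * growth)             ≡⟨ cong (N *_) (*-comm (growth ^ j) growth) ⟩
      N * growth ^ suc j                    ∎
      where
      open ≤-Reasoning
      N = length (filter (λ G → ¬? (resilient? r Hamiltonian hamiltonian? G)) Gs)

-- Resilient graphs have linearly many absorbable vertices.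

module _ {n r d m h s : ℕ} (1≤r : 1 ≤ r) (d≡1+2r : d ≡ suc (2 * r)) (n≡2h : n ≡ 2 * h) where

  private
    -- The number of usable vertices that `Absorbs` demands for `j = d`, a value that bounds the
    -- inner degree of any vertex.
    τ : ℕ
    τ = m + 3 * d

  module _ (2τ≤h : 2 * τ ≤ h) (s+τd≤h : s + τ * d ≤ h) where

    module _ (G : Graph n) (regular : Regular d G) (resilient : Resilient r Hamiltonian G) where

      private
        absorbing : List (Fin n)
        absorbing = filter (λ v → absorbable? r m d G v) (allFin n)

        sparse⇒≤h : (B : Subset n) → (∀ {u} → u ∈ B → inside-degree G B u ≤ r) → ∣ B ∣ ≤ h
        sparse⇒≤h B sparse = *-cancelˡ-≤ 2 (subst (2 * ∣ B ∣ ≤_) n≡2h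
          (≮⇒≥ λ large → sparse-majority⇒¬resilient r G B large sparse resilient))

        -- Resilience limits each side to `h` vertices, and the two sides have `2 * h` together.
        halves : (B : Subset n) → (∀ {u} → u ∈ B → inside-degree G B u ≤ r) →
                 (∀ {u} → u ∈ ∁ B → inside-degree G (∁ B) u ≤ r) → h ≤ ∣ B ∣ × h ≤ ∣ ∁ B ∣
        halves B sparse sparse∁ =
            +-cancelʳ-≤ h h _ (≤-trans total (+-monoʳ-≤ _ (sparse⇒≤h (∁ B) sparse∁)))
          , +-cancelˡ-≤ h h _ (≤-trans total (+-monoˡ-≤ _ (sparse⇒≤h B sparse)))
          where
          total : h + h ≤ ∣ B ∣ + ∣ ∁ B ∣
          total = ≤-reflexive (sym (trans (∣p∣+∣∁p∣≡n B) (trans n≡2h (cong (h +_) (+-identityʳ h)))))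

        few-d : ∀ {B v} → inside-degree G B v ≤ d
        few-d {B} {v} = subst (inside-degree G B v ≤_) (regular v) (∣p∩q∣≤∣p∣ (neighbours G v) B)

        half-size : (B : Subset n) → h ≤ ∣ B ∣ → n ≤ 2 * ∣ B ∣
        half-size B h≤B = subst (_≤ 2 * ∣ B ∣) (sym n≡2h) (*-monoʳ-≤ 2 h≤B)

      many-absorbing : s ≤ length absorbing
      many-absorbing with sparseBipartition r G (λ u → trans (regular u) d≡1+2r)
      ... | B , sparse , sparse∁ with τ ≤? ∣ subset (usable? r m outer G B) ∣
      -- With enough edges outside `B`, every vertex outside `B` is absorbable into `B` in outer
      -- mode.
      ...   | yes τ≤usable = begin
        s                  ≤⟨ m≤m+n s (τ * d) ⟩
        s + τ * d          ≤⟨ s+τd≤h ⟩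
        h                  ≤⟨ h≤∁B ⟩
        ∣ ∁ B ∣            ≤⟨ card-≤ (∁ B) absorbing (λ v∈∁B →
                               ∈-filter⁺ (λ v → absorbable? r m d G v) (∈-allFin _) (B , inj₁ (absorbs v∈∁B))) ⟩
        length absorbing   ∎
        where
        open ≤-Reasoning
        h≤B : h ≤ ∣ B ∣
        h≤B = proj₁ (halves B sparse sparse∁)
        h≤∁B : h ≤ ∣ ∁ B ∣
        h≤∁B = proj₂ (halves B sparse sparse∁)
        absorbs : ∀ {v} → v ∈ ∁ B → Absorbs r m outer d G v B
        absorbs {v} v∈∁B = record
          { v∉B = x∈∁p⇒x∉p v∈∁B ; half = half-size B h≤B ; sparse = λ u → sparse
          ; few = few-d ; rich = τ≤usable ; slack = _ }
      -- Otherwise fewer than `τ` vertices outside `B` have a neighbour outside `B`; they form `U`.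
      -- Now `∁ B` is the half to be enlarged, in inner mode, and each `v` in `B` without a
      -- neighbour in `U` is absorbable. At most `τ * d` vertices have such a neighbour.
      ...   | no τ≰usable = +-cancelʳ-≤ (τ * d) s (length absorbing) (begin
        s + τ * d                                         ≤⟨ s+τd≤h ⟩
        h                                                 ≤⟨ h≤B ⟩
        ∣ B ∣                                             ≤⟨ card-≤ B (absorbing ++ nearUsable) covered ⟩
        length (absorbing ++ nearUsable)                  ≡⟨ List.length-++ absorbing ⟩
        length absorbing + length nearUsable              ≤⟨ +-monoʳ-≤ (length absorbing) (≤-trans
            (length-concatMap-≤ (nbrs G) (elements U) (≤-reflexive ∘ length-nbrs G regular))
            (*-monoˡ-≤ d (≤-trans (≤-reflexive (length-elements U)) U≤τ))) ⟩
        length absorbing + τ * d                          ∎)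
        where
        open ≤-Reasoning
        h≤B : h ≤ ∣ B ∣
        h≤B = proj₁ (halves B sparse sparse∁)
        h≤∁B : h ≤ ∣ ∁ B ∣
        h≤∁B = proj₂ (halves B sparse sparse∁)
        U : Subset n
        U = subset (usable? r m outer G B)
        U≤τ : ∣ U ∣ ≤ τ
        U≤τ = <⇒≤ (≰⇒> τ≰usable)
        nearUsable : List (Fin n)
        nearUsable = concatMap (nbrs G) (elements U)

        -- An inner degree of at least `r` is positive because `1 ≤ r`, so `y` has a neighbour
        -- outside `B`.
        tight⇒usable : ∀ {y} → y ∈ ∁ B → ¬ inside-degree G (∁ B) y < r → y ∈ U
        tight⇒usable {y} y∈∁B tight with Fin.any? (λ x → adjacent? G y x ×-dec ¬? (x ∈? B))
        ... | yes e = ∈-subset⁺ (usable? r m outer G B) (x∈∁p⇒x∉p y∈∁B , e)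
        ... | no ¬e = contradiction
          (≤-<-trans
            (card-≤ (neighbours G y ∩ ∁ B) [] λ p → let (a , b) = x∈p∩q⁻ (neighbours G y) _ p in
              contradiction (_ , a , x∈∁p⇒x∉p b) ¬e) 1≤r)
          tight

        rich : τ ≤ ∣ subset (usable? r m inner G (∁ B)) ∣
        rich = +-cancelʳ-≤ τ τ _ (begin
          τ + τ                  ≡⟨ cong (τ +_) (+-identityʳ τ) ⟨
          2 * τ                  ≤⟨ 2τ≤h ⟩
          h                      ≤⟨ h≤∁B ⟩
          ∣ ∁ B ∣                ≤⟨ card-≤ (∁ B) (elements V ++ elements U) covered′ ⟩
          length (elements V ++ elements U)           ≡⟨ List.length-++ (elements V) ⟩
          length (elements V) + length (elements U)   ≡⟨ cong₂ _+_ (length-elements V) (length-elements U) ⟩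
          ∣ V ∣ + ∣ U ∣                               ≤⟨ +-monoʳ-≤ ∣ V ∣ U≤τ ⟩
          ∣ V ∣ + τ              ∎)
          where
          V : Subset n
          V = subset (usable? r m inner G (∁ B))
          covered′ : ∀ {y} → y ∈ ∁ B → y ∈ˡ elements V ++ elements U
          covered′ {y} y∈ with inside-degree G (∁ B) y <? r
          ... | yes lt = ∈-++⁺ˡ (∈-elements⁺ (∈-subset⁺ (usable? r m inner G (∁ B)) (y∈ , lt)))
          ... | no ¬lt = ∈-++⁺ʳ (elements V) (∈-elements⁺ (tight⇒usable y∈ ¬lt))

        covered : ∀ {v} → v ∈ B → v ∈ˡ absorbing ++ nearUsable
        covered {v} v∈B with DecMembership._∈?_ Fin._≟_ v nearUsable
        ... | yes p = ∈-++⁺ʳ absorbing p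
        ... | no ¬p = ∈-++⁺ˡ (∈-filter⁺ (λ v → absorbable? r m d G v) (∈-allFin v) (∁ B , inj₂ (record
          { v∉B = x∈p⇒x∉∁p v∈B ; half = half-size (∁ B) h≤∁B ; sparse = λ u → sparse∁ ; few = few-d ; rich = rich
          -- A neighbour `w` of `v` without room would lie in `U`, which puts `v` into `nearUsable`.
          ; slack = λ w a w∈ → decidable-stable (inside-degree G (∁ B) w <? r) λ tight →
              ¬p (∈-concatMap-intro (nbrs G) (∈-elements⁺ (tight⇒usable w∈ tight))
                (∈-elements⁺ (Adjacent-sym G v w a))) })))

-- From counts of graphs to probabilities.

p≤∣p∣ : ∀ p → p ℚ.≤ ℚ.∣ p ∣
p≤∣p∣ p with ℚ.≤-total ℚ.0ℚ p
... | inj₁ 0≤p = ℚ.≤-reflexive (sym (ℚ.0≤p⇒∣p∣≡p 0≤p))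
... | inj₂ p≤0 = ℚ.≤-trans p≤0 (ℚ.0≤∣p∣ p)

distance-from-1 : ∀ p ε → ℚ.∣ p ℚ.- ℚ.1ℚ ∣ ℚ.< ε → ℚ.1ℚ ℚ.< ε ℚ.+ p
distance-from-1 p ε lt = subst (ℚ._< ε ℚ.+ p) eq (ℚ.+-monoˡ-< p (ℚ.≤-<-trans below lt))
  where
  below : ℚ.- (p ℚ.- ℚ.1ℚ) ℚ.≤ ℚ.∣ p ℚ.- ℚ.1ℚ ∣
  below = subst (ℚ.- (p ℚ.- ℚ.1ℚ) ℚ.≤_) (ℚ.∣-p∣≡∣p∣ (p ℚ.- ℚ.1ℚ)) (p≤∣p∣ (ℚ.- (p ℚ.- ℚ.1ℚ)))
  eq : ℚ.- (p ℚ.- ℚ.1ℚ) ℚ.+ p ≡ ℚ.1ℚ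
  eq = begin
    ℚ.- (p ℚ.- ℚ.1ℚ) ℚ.+ p          ≡⟨ cong (ℚ._+ p) (ℚ.neg-distrib-+ p (ℚ.- ℚ.1ℚ)) ⟩
    (ℚ.- p ℚ.+ ℚ.1ℚ) ℚ.+ p          ≡⟨ cong (ℚ._+ p) (ℚ.+-comm (ℚ.- p) ℚ.1ℚ) ⟩
    (ℚ.1ℚ ℚ.+ ℚ.- p) ℚ.+ p          ≡⟨ ℚ.+-assoc ℚ.1ℚ (ℚ.- p) p ⟩
    ℚ.1ℚ ℚ.+ (ℚ.- p ℚ.+ p)          ≡⟨ cong (ℚ.1ℚ ℚ.+_) (ℚ.+-inverseˡ p) ⟩
    ℚ.1ℚ ℚ.+ ℚ.0ℚ                   ≡⟨ ℚ.+-identityʳ ℚ.1ℚ ⟩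
    ℚ.1ℚ                            ∎
    where open ≡-Reasoning

-- Denominators are cleared in the unnormalised rationals, where the sum is literally a fraction
-- over `suc K * suc t`.
1<1/+k/ : ∀ K k t → ℚ.1ℚ ℚ.< ℤ.+ 1 ℚ./ suc K ℚ.+ ℤ.+ k ℚ./ suc t → suc K * suc t < suc t + k * suc K
1<1/+k/ K k t lt = ℤ.drop‿+<+ (subst₂ ℤ._<_ (ℤ.*-identityˡ (ℤ.+ (suc K * suc t)))
  (trans (ℤ.*-identityʳ _)
    (cong₂ ℤ._+_ (ℤ.*-identityˡ (ℤ.+ suc t)) (sym (ℤ.pos-* k (suc K))))) (ℚᵘ.drop-*<* unnormalised))
  where
  unnormalised : ℚᵘ.1ℚᵘ ℚᵘ.< ℚᵘ.mkℚᵘ (ℤ.+ 1) K ℚᵘ.+ ℚᵘ.mkℚᵘ (ℤ.+ k) t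
  unnormalised = ℚᵘ.<-respʳ-≃
    (ℚᵘ.≃-trans (ℚ.toℚᵘ-homo-+ (ℤ.+ 1 ℚ./ suc K) (ℤ.+ k ℚ./ suc t))
      (ℚᵘ.+-cong (ℚ.toℚᵘ-fromℚᵘ (ℚᵘ.mkℚᵘ (ℤ.+ 1) K)) (ℚ.toℚᵘ-fromℚᵘ (ℚᵘ.mkℚᵘ (ℤ.+ k) t))))
    (ℚ.toℚᵘ-mono-< lt)

-- For k + l = 0 the junk value 0 of ratio is far from 1 as well.
ratio-far-from-1 : ∀ k l K → k ≤ l * K → ¬ ℚ.∣ ratio k (k + l) ℚ.- ℚ.1ℚ ∣ ℚ.< ℤ.+ 1 ℚ./ suc K
ratio-far-from-1 k l K k≤lK lt with k + l in eq
... | zero  = <⇒≱ (1<1/+k/ K 0 0 (distance-from-1 (ℤ.+ 0 ℚ./ 1) _ lt)) (s≤s z≤n)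
... | suc t = <⇒≱ (1<1/+k/ K k t (distance-from-1 (ℤ.+ k ℚ./ suc t) _ lt)) (begin
  suc t + k * suc K       ≡⟨ cong (suc t +_) (*-suc k K) ⟩
  suc t + (k + k * K)     ≤⟨ +-monoʳ-≤ (suc t) (+-monoˡ-≤ (k * K) k≤lK) ⟩
  suc t + (l * K + k * K)
    ≡⟨ cong (suc t +_) (trans (sym (*-distribʳ-+ K l k)) (cong (_* K) (trans (+-comm l k) eq))) ⟩
  suc t + suc t * K       ≡⟨ *-suc (suc t) K ⟨
  suc t * suc K           ≡⟨ *-comm (suc t) (suc K) ⟩
  suc K * suc t           ∎)
  where open ≤-Reasoning

-- If the graphs with `P` number at most `K` times the others, the probability is at most
-- `K / (K + 1)`. For arbitrarily large `n` this contradicts convergence at `ε = 1 / (K + 1)`.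
frequently-bounded⇒¬almostSurely : ∀ d (P : GraphProperty) (P? : ∀ {n} (G : Graph n) → Dec (P G)) K →
  (∀ N → ∃ λ n → N ≤ n × d < n × 2 ∣ n * d ×
    length (filter P? (regularGraphs n d)) ≤ length (filter (λ G → ¬? (P? G)) (regularGraphs n d)) * K) →
  ¬ AlmostSurely d P P?
frequently-bounded⇒¬almostSurely d P P? K frequently aas
  with aas (ℤ.+ 1 ℚ./ suc K) (ℚ.positive⁻¹ (ℤ.+ 1 ℚ./ suc K) {{ℚ.normalize-pos 1 (suc K)}})
... | N , close with frequently N
...   | n , N≤n , d<n , 2∣nd , few = ratio-far-from-1 k l K few
  (subst (λ t → ℚ.∣ ratio k t ℚ.- ℚ.1ℚ ∣ ℚ.< ℤ.+ 1 ℚ./ suc K)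
    (sym (length-filter-split P? (regularGraphs n d))) (close n N≤n d<n 2∣nd))
  where
  k = length (filter P? (regularGraphs n d))
  l = length (filter (λ G → ¬? (P? G)) (regularGraphs n d))

-- Choice of parameters and conclusion.

odd⇒suc-double : ∀ d → ¬ (2 ∣ d) → d ≡ suc (2 * ((d ∸ 1) / 2))
odd⇒suc-double d odd = trans d≡ (cong (λ k → suc (2 * k)) (sym half))
  where
  d%2 : ∀ k → k ≡ d % 2 → k < 2 → d % 2 ≡ 1
  d%2 zero          eq lt = contradiction (m%n≡0⇒n∣m d 2 (sym eq)) odd
  d%2 (suc zero)    eq lt = sym eq
  d%2 (suc (suc k)) eq (s≤s (s≤s ()))

  d≡suc : d ≡ suc (d / 2 * 2)
  d≡suc = trans (m≡m%n+[m/n]*n d 2) (cong (_+ d / 2 * 2) (d%2 (d % 2) refl (m%n<n d 2)))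

  d≡ : d ≡ suc (2 * (d / 2))
  d≡ = trans d≡suc (cong suc (*-comm (d / 2) 2))

  half : (d ∸ 1) / 2 ≡ d / 2
  half = trans (cong (λ k → (k ∸ 1) / 2) d≡suc) (m*n/n≡m (d / 2) 2)

module _ (r d : ℕ) (1≤r : 1 ≤ r) (d≡1+2r : d ≡ suc (2 * r)) where

  private
    resilientGraph? : ∀ {n} (G : Graph n) → Dec (Resilient r Hamiltonian G)
    resilientGraph? = resilient? r Hamiltonian hamiltonian?

    #resilient #nonresilient : ℕ → ℕ
    #resilient    n = length (filter resilientGraph? (regularGraphs n d))
    #nonresilient n = length (filter (λ G → ¬? (resilientGraph? G)) (regularGraphs n d))

    r<d : r < d
    r<d = subst (r <_) (sym d≡1+2r) (s≤s (m≤n*m r 2))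

    -- The bound from `length-closeTo`; thus `s + e` is the `m` of the switching argument.
    e : ℕ
    e = 2 + (d + (d + d * d))

    -- Counts pairs of a resilient graph and a vertex absorbable in it: at least `s` for each graph,
    -- at most `#nonresilient n * growthFactor d q ^ d` for each of the `q * s` vertices. Again `s`
    -- cancels.
    few-resilient : ∀ {n h q s} .{{_ : NonZero s}} → n ≡ q * s → n ≡ 2 * h →
                    2 * (s + e + 3 * d) ≤ h → s + (s + e + 3 * d) * d ≤ h →
                    #resilient n ≤ #nonresilient n * (q * growthFactor d q ^ d)
    few-resilient {n} {h} {q} {s} n≡qs n≡2h 2τ≤h s+τd≤h =
      *-cancelʳ-≤ (#resilient n) (#nonresilient n * (q * g)) s (begin
      #resilient n * s
        ≤⟨ double-counting (absorbable? r m d) (filter resilientGraph? Gs) (allFin n) lower upper ⟩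
      length (allFin n) * (#nonresilient n * g)
        ≡⟨ cong (_* (#nonresilient n * g)) (trans (List.length-tabulate {n = n} id) n≡qs) ⟩
      q * s * (#nonresilient n * g)
        ≡⟨ arith q s (#nonresilient n) g ⟩
      #nonresilient n * (q * g) * s
        ∎)
      where
      open ≤-Reasoning
      Gs = regularGraphs n d
      m = s + e
      g = growthFactor d q ^ d

      arith : ∀ q s a g → q * s * (a * g) ≡ a * (q * g) * s
      arith = solve 4 (λ q s a g → q :* s :* (a :* g) := a :* (q :* g) :* s) refl
        where open +-*-Solver

      lower : ∀ G → G ∈ˡ filter resilientGraph? Gs → s ≤ length (filter (absorbable? r m d G) (allFin n))
      lower G G∈ = let (G∈Gs , resilient) = ∈-filter⁻ resilientGraph? {xs = Gs} G∈ in
        many-absorbing 1≤r d≡1+2r n≡2h 2τ≤h s+τd≤h G (∈-regularGraphs⁻ G∈Gs) resilient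

      upper : ∀ v → v ∈ˡ allFin n →
              length (filter (λ G → absorbable? r m d G v) (filter resilientGraph? Gs)) ≤ #nonresilient n * g
      upper v _ = ≤-trans
        (length-⊆
          (Unique.filter⁺ (λ G → absorbable? r m d G v) (Unique.filter⁺ resilientGraph? (regularGraphs-unique n d)))
          (λ p → let (G∈ , ab) = ∈-filter⁻ (λ G → absorbable? r m d G v) {xs = filter resilientGraph? Gs} p in
            ∈-filter⁺ (λ G → absorbable? r m d G v) (proj₁ (∈-filter⁻ resilientGraph? {xs = Gs} G∈)) ab))
        (absorbable-bound n r s d r<d q n≡qs d v)

    module _ (s : ℕ) (large : e + 3 * d ≤ s) where

      private
        τ : ℕ
        τ = s + e + 3 * d

      τ≤2s : τ ≤ 2 * s
      τ≤2s = begin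
        s + e + 3 * d               ≡⟨ +-assoc s e (3 * d) ⟩
        s + (e + 3 * d)             ≤⟨ +-monoʳ-≤ s large ⟩
        s + s                       ≡⟨ cong (s +_) (+-identityʳ s) ⟨
        2 * s                       ∎
        where open ≤-Reasoning

      2τ≤[4+2d]s : 2 * τ ≤ (4 + 2 * d) * s
      2τ≤[4+2d]s = begin
        2 * τ           ≤⟨ *-monoʳ-≤ 2 τ≤2s ⟩
        2 * (2 * s)     ≡⟨ *-assoc 2 2 s ⟨
        4 * s           ≤⟨ *-monoˡ-≤ s (m≤m+n 4 (2 * d)) ⟩
        (4 + 2 * d) * s           ∎
        where open ≤-Reasoning

      s+τd≤[4+2d]s : s + τ * d ≤ (4 + 2 * d) * s
      s+τd≤[4+2d]s = begin
        s + τ * d             ≤⟨ +-monoʳ-≤ s (*-monoˡ-≤ d τ≤2s) ⟩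
        s + 2 * s * d         ≡⟨ arith s d ⟩
        (1 + 2 * d) * s       ≤⟨ *-monoˡ-≤ s (+-monoˡ-≤ (2 * d) {1} {4} (s≤s z≤n)) ⟩
        (4 + 2 * d) * s                 ∎
        where
        open ≤-Reasoning
        arith : ∀ s d → s + 2 * s * d ≡ (1 + 2 * d) * s
        arith = solve 2 (λ s d → s :+ con 2 :* s :* d := (con 1 :+ con 2 :* d) :* s) refl
          where open +-*-Solver

    -- With `τ ≤ 2 * s`, the two size conditions ask for `4 * s ≤ h` and `(1 + 2 * d) * s ≤ h`. Both
    -- hold for `h = (4 + 2 * d) * s`, and `q * s` is twice this `h`. As `q` depends on `d` alone,
    -- so does `K`.
    q K : ℕ
    q = 2 * (4 + 2 * d)
    K = q * growthFactor d q ^ d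

    few-resilient-beyond : ∀ N → ∃ λ n → N ≤ n × d < n × 2 ∣ n * d × #resilient n ≤ #nonresilient n * K
    few-resilient-beyond N =
      q * s
      , ≤-trans (≤-trans (m≤m+n N (e + 3 * d)) (n≤1+n _)) (m≤n*m s q)
      , ≤-trans (s≤s (≤-trans (m≤n*m d 3) (≤-trans (m≤n+m (3 * d) e) (m≤n+m (e + 3 * d) N)))) (m≤n*m s q)
      , ∣m⇒∣m*n d (∣m⇒∣m*n s (m∣m*n (4 + 2 * d)))
      , few-resilient {h = (4 + 2 * d) * s} {q} {s} refl (*-assoc 2 (4 + 2 * d) s)
          (2τ≤[4+2d]s s large) (s+τd≤[4+2d]s s large)
      where
      -- Large enough for `N ≤ n`, `d < n` and `τ ≤ 2 * s`; the successor makes `s` nonzero and the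
      -- bound on `d` strict.
      s = suc (N + (e + 3 * d))
      large : e + 3 * d ≤ s
      large = ≤-trans (m≤n+m (e + 3 * d) N) (n≤1+n _)

  not-almost-surely : ¬ AlmostSurely d (Resilient r Hamiltonian) (resilient? r Hamiltonian hamiltonian?)
  not-almost-surely =
    frequently-bounded⇒¬almostSurely d (Resilient r Hamiltonian) resilientGraph? K few-resilient-beyond

theorem1p3 : (d : ℕ) → ¬ (2 ∣ d) → 2 < d →
    ¬ AlmostSurely d (Resilient ((d ∸ 1) / 2) Hamiltonian) (resilient? ((d ∸ 1) / 2) Hamiltonian hamiltonian?)
theorem1p3 d odd 2<d = not-almost-surely r d (1≤r r (subst (2 <_) d≡1+2r 2<d)) d≡1+2r
  where
  r = (d ∸ 1) / 2
  d≡1+2r = odd⇒suc-double d odd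
  1≤r : ∀ k → 2 < suc (2 * k) → 1 ≤ k
  1≤r zero    (s≤s ())
  1≤r (suc k) _ = s≤s z≤n
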